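{- Let $S_n$ and $s_n$ denote the large and small Schröder numbers, let $D_{\pm}(a_1,\ldots,a_n)$ denote the $n\times n$ Hessenberg--Toeplitz determinant with superdiagonal entries $\pm 1$, and let $A134425[n]$, $A225887[n]$, $A114710[n]$ ($n\ge 0$) be the integer sequences defined in the context. Then the following formulas hold for all $n\ge 1$, unless stated otherwise: \begin{align*} D_{+}(S_1,S_2,\ldots,S_n)&=(-1)^{n-1}S_{n-1}\quad (n\ge 2),\\ D_{ - }(S_1,S_2,\ldots,S_n)&=2\cdot A134425[n-1],\\ D_{+}(S_0,S_1,\ldots,S_{n-1})&=(-1)^{n-1}s_{n-1},\\ D_{ - }(S_0,S_1,\ldots,S_{n-1})&=s_n,\\ D_{+}(s_1,s_2,\ldots,s_n)&=(-1)^{n-1}S_{n-1},\\ D_{ - }(s_1,s_2,\ldots,s_n)&=A225887[n-1],\\ D_{+}(s_0,s_1,\ldots,s_{n-1})&=(-1)^{n-1}A114710[n-1],\\ D_{ - }(s_0,s_1,\ldots,s_{n-1})&=S_{n-1},\\ D_{+}(s_2,s_3,\ldots,s_{n+1})&=(-1)^{n-1}S_{n-1}\quad (n\ge 2). \end{align*}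
   Context: Large Schröder numbers: $S_0=1$ and $S_n=\frac1n\sum_{k=1}^n 2^k\binom nk\binom n{k-1}$ for $n\ge 1$. Small Schröder numbers: $s_0=1$ and $s_n=\frac12 S_n$ for $n\ge1$. Determinants: for $a_0\in\{1,-1\}$ and numbers $a_1,\ldots,a_n$, let $A_n(a_0;a_1,\ldots,a_n)$ be the $n\times n$ matrix whose $(i,j)$ entry is $a_{i-j+1}$ if $j\le i$, $a_0$ if $j=i+1$, and $0$ if $j>i+1$. Put $D_{+}(a_1,\ldots,a_n)=\det A_n(1;a_1,\ldots,a_n)$ and $D_{ - }(a_1,\ldots,a_n)=\det A_n(-1;a_1,\ldots,a_n)$. Schröder paths: for $n\ge0$, $\mathcal P_n$ is the set of lattice paths from $(0,0)$ to $(2n,0)$ with steps $u=(1,1)$, $d=(1,-1)$, $h=(2,0)$ that never go below the $x$-axis ($\mathcal P_0$ consists of the empty path only). A low $h$ step is an $h$ step lying on the $x$-axis; $\mathrm{low}(\lambda)$ denotes the number of low $h$ steps of $\lambda$. A peak of height $1$ is a $u$ step ending at height $1$ immediately followed by a $d$ step. OEIS sequences ($n\ge 0$): $A134425[n]=\sum_{\lambda\in\mathcal P_n}4^{\mathrm{low}(\lambda)}$ (Schröder paths whose low $h$ steps come in four kinds); $A225887[n]=\sum_{\lambda\in\mathcal P_n}3^{\mathrm{low}(\lambda)}$ (Schröder paths whose low $h$ steps come in three colors); $A114710[n]$ is the number of $\lambda\in\mathcal P_n$ having no low $h$ steps and no peaks of height $1$. -}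

module Defs where

open import Data.Bool.Base using (if_then_else_)
open import Data.Empty using (⊥)
open import Data.Fin.Base using (Fin; zero; suc; toℕ; fromℕ<; punchIn)
open import Data.Fin.Properties using (toℕ<n)
open import Data.Integer.Base as ℤ using (ℤ; +_; 0ℤ; 1ℤ; -1ℤ)
import Data.Integer.Properties as ℤ
open import Data.List.Base using (List; []; _∷_; [_]; _++_; map; filter; length)
open import Data.List.Membership.Propositional using (_∈_)
open import Data.List.Membership.Propositional.Properties
  using (∈-map⁺; ∈-map⁻; ∈-++⁺ˡ; ∈-++⁺ʳ; ∈-++⁻)
open import Data.List.Relation.Unary.Any using (here)
open import Data.List.Relation.Unary.All using ([])
open import Data.List.Relation.Unary.AllPairs using ([]; _∷_)
open import Data.List.Relation.Unary.Unique.Propositional using (Unique)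
import Data.List.Relation.Unary.Unique.Propositional.Properties as Unique
open import Data.Nat.Base using (ℕ; zero; suc; _+_; _*_; _^_; _/_; z≤n; s≤s)
open import Data.Nat.Combinatorics using (_C_; nC1≡n; nCk+nC[k+1]≡[n+1]C[k+1]; k>n⇒nCk≡0)
open import Data.Nat.Divisibility
open import Data.Nat.DivMod using (m/n*n≡m)
import Data.Nat.ListAction as List
open import Data.Nat.Properties as ℕ using (_≟_; _≤?_)
open import Data.Nat.Tactic.RingSolver using (solve-∀)
open import Data.Product.Base using (_×_; _,_)
open import Data.Sum.Base using (_⊎_; inj₁; inj₂)
open import Data.Vec.Functional using (Vector)
open import Relation.Binary.PropositionalEquality
  using (_≡_; refl; sym; trans; cong; cong₂; subst; subst₂; module ≡-Reasoning)
open import Relation.Nullary.Decidable using (does; _×-dec_)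

open import Algebra.Properties.Semiring.Sum ℕ.+-*-semiring using (sum)
import Algebra.Properties.Semiring.Sum ℤ.+-*-semiring as ℤΣ

-- With the summation index k = i + 1, where 0 ≤ i < n.
schröderTerm : (n i : ℕ) → ℕ
schröderTerm n i = 2 ^ suc i * ((n C suc i) * (n C i))

schröderSum : ℕ → ℕ
schröderSum n = sum {n} (λ i → schröderTerm n (toℕ i))

-- Both divisions below are exact: see n*S≡schröderSum and 2*s≡S.
S : ℕ → ℕ
S zero      = 1
S n@(suc _) = schröderSum n / n

s : ℕ → ℕ
s zero      = 1
s n@(suc _) = S n / 2

private
  absorption : ∀ m k → suc k * (suc m C suc k) ≡ suc m * (m C k)
  absorption zero zero = refl
  absorption zero (suc k)
    rewrite k>n⇒nCk≡0 {1} {suc (suc k)} (s≤s (s≤s z≤n))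
          = ℕ.*-zeroʳ k
  absorption (suc m) zero
    rewrite nC1≡n (suc (suc m)) = lemma m
    where
    lemma : ∀ m → suc (suc m) + 0 ≡ suc (suc m) * 1
    lemma = solve-∀
  absorption (suc m) (suc k) = begin
    suc (suc k) * (suc (suc m) C suc (suc k))
      ≡⟨ cong (suc (suc k) *_) (nCk+nC[k+1]≡[n+1]C[k+1] (suc m) (suc k)) ⟨
    suc (suc k) * (x + y)
      ≡⟨ expand k x y ⟩
    x + suc k * x + suc (suc k) * y
      ≡⟨ cong₂ (λ a b → x + a + b) (absorption m k) (absorption m (suc k)) ⟩
    x + suc m * (m C k) + suc m * (m C suc k)
      ≡⟨ collect m x (m C k) (m C suc k) ⟩
    x + suc m * (m C k + m C suc k)
      ≡⟨ cong (λ a → x + suc m * a) (nCk+nC[k+1]≡[n+1]C[k+1] m k) ⟩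
    suc (suc m) * x ∎
    where
    open ≡-Reasoning
    x = suc m C suc k
    y = suc m C suc (suc k)
    expand : ∀ k x y → suc (suc k) * (x + y) ≡ x + suc k * x + suc (suc k) * y
    expand = solve-∀
    collect : ∀ m x a b → x + suc m * a + suc m * b ≡ x + suc m * (a + b)
    collect = solve-∀

  n∣k*nCk : ∀ m k → suc m ∣ k * (suc m C k)
  n∣k*nCk m zero    = suc m ∣0
  n∣k*nCk m (suc k) = subst (suc m ∣_) (sym (absorption m k)) (m∣m*n (m C k))

  n∣nC[k+1]*nCk : ∀ m k → suc m ∣ (suc m C suc k) * (suc m C k)
  n∣nC[k+1]*nCk m k = ∣m+n∣m⇒∣n n∣kp+p n∣kp
    where
    a = suc m C suc k
    b = suc m C k
    regroup₁ : ∀ k a b → suc k * a * b ≡ k * b * a + a * b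
    regroup₁ = solve-∀
    n∣kp : suc m ∣ k * b * a
    n∣kp = ∣m⇒∣m*n a (n∣k*nCk m k)
    n∣kp+p : suc m ∣ k * b * a + a * b
    n∣kp+p = subst (suc m ∣_) (regroup₁ k a b) (∣m⇒∣m*n b (n∣k*nCk m (suc k)))

  ∣sum : ∀ {d n} (f : Vector ℕ n) → (∀ i → d ∣ f i) → d ∣ sum f
  ∣sum {d} {zero}  f d∣f = d ∣0
  ∣sum {d} {suc n} f d∣f = ∣m∣n⇒∣m+n (d∣f zero) (∣sum (λ i → f (suc i)) (λ i → d∣f (suc i)))

  2n∣schröderTerm : ∀ m i → 2 * suc m ∣ schröderTerm (suc m) i
  2n∣schröderTerm m i = *-pres-∣ (m∣m*n {2} (2 ^ i)) (n∣nC[k+1]*nCk m i)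

2n∣schröderSum : ∀ m → 2 * suc m ∣ schröderSum (suc m)
2n∣schröderSum m = ∣sum {n = suc m} _ (λ i → 2n∣schröderTerm m (toℕ i))

n*S≡schröderSum : ∀ m → suc m * S (suc m) ≡ schröderSum (suc m)
n*S≡schröderSum m = trans (ℕ.*-comm (suc m) (S (suc m)))
  (m/n*n≡m (∣-trans (n∣m*n 2) (2n∣schröderSum m)))

2*s≡S : ∀ m → 2 * s (suc m) ≡ S (suc m)
2*s≡S m = trans (ℕ.*-comm 2 (s (suc m))) (m/n*n≡m 2∣S)
  where
  2∣S : 2 ∣ S (suc m)
  2∣S = *-cancelˡ-∣ (suc m) (subst₂ _∣_ (ℕ.*-comm 2 (suc m)) (sym (n*S≡schröderSum m))
                              (2n∣schröderSum m))

Matrix : ℕ → Set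
Matrix n = Fin n → Fin n → ℤ

minor : ∀ {n} → Matrix (suc n) → Fin (suc n) → Fin (suc n) → Matrix n
minor M i j k l = M (punchIn i k) (punchIn j l)

-- Laplace expansion along the first row.
det : ∀ {n} → Matrix n → ℤ
det {zero}  M = 1ℤ
det {suc n} M = ℤΣ.sum λ j → -1ℤ ℤ.^ toℕ j ℤ.* M zero j ℤ.* det (minor M zero j)

-- The numbers a₁ , … , aₙ are given as a vector indexed from 0, so that
-- position i of the vector holds aᵢ₊₁; rows and columns are likewise
-- indexed from 0, and a_{i-j+1} is found at position i ∸ j.
A : ∀ {n} → ℤ → Vector ℤ n → Matrix n
A a₀ a i j =
  if does (toℕ j ≤? toℕ i) then a (fromℕ< i∸j<n)
  else if does (toℕ j ≟ suc (toℕ i)) then a₀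
  else 0ℤ
  where
  i∸j<n = ℕ.≤-<-trans (ℕ.m∸n≤m (toℕ i) (toℕ j)) (toℕ<n i)

D₊ D₋ : ∀ {n} → Vector ℤ n → ℤ
D₊ a = det (A 1ℤ a)
D₋ a = det (A -1ℤ a)

seg : ℕ → (n : ℕ) → (ℕ → ℕ) → Vector ℤ n
seg m n f i = + f (m + toℕ i)

-- Path y ℓ is the type of lattice paths with steps u, d, h which start at
-- height y, end on the x-axis after a horizontal distance ℓ, and never go
-- below the x-axis.
data Path : (y ℓ : ℕ) → Set where
  []  : Path 0 0
  u∷_ : ∀ {y ℓ} → Path (suc y) ℓ → Path y (suc ℓ)
  d∷_ : ∀ {y ℓ} → Path y ℓ → Path (suc y) (suc ℓ)
  h∷_ : ∀ {y ℓ} → Path y ℓ → Path y (suc (suc ℓ))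

infixr 5 u∷_ d∷_ h∷_

𝒫 : ℕ → Set
𝒫 n = Path 0 (2 * n)

low : ∀ {y ℓ} → Path y ℓ → ℕ
low []             = 0
low (u∷ p)         = low p
low (d∷ p)         = low p
low {zero}  (h∷ p) = suc (low p)
low {suc _} (h∷ p) = low p

peaks₁ : ∀ {y ℓ} → Path y ℓ → ℕ
peaks₁ []                  = 0
peaks₁ {zero}  (u∷ (d∷ p)) = suc (peaks₁ p)
peaks₁ {zero}  (u∷ (u∷ p)) = peaks₁ (u∷ p)
peaks₁ {zero}  (u∷ (h∷ p)) = peaks₁ (h∷ p)
peaks₁ {suc _} (u∷ p)      = peaks₁ p
peaks₁ (d∷ p)              = peaks₁ p
peaks₁ (h∷ p)              = peaks₁ p

paths  : ∀ y ℓ → List (Path y ℓ)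
upFrom downFrom levelFrom : ∀ y ℓ → List (Path y (suc ℓ))

paths y       (suc ℓ) = upFrom y ℓ ++ downFrom y ℓ ++ levelFrom y ℓ
paths zero    zero    = [ [] ]
paths (suc y) zero    = []

upFrom y ℓ = map u∷_ (paths (suc y) ℓ)

downFrom zero    ℓ = []
downFrom (suc y) ℓ = map d∷_ (paths y ℓ)

levelFrom y zero    = []
levelFrom y (suc ℓ) = map h∷_ (paths y ℓ)

∈-paths : ∀ {y ℓ} (p : Path y ℓ) → p ∈ paths y ℓ
∈-paths []                 = here refl
∈-paths (u∷ p)             = ∈-++⁺ˡ (∈-map⁺ u∷_ (∈-paths p))
∈-paths {suc y} {suc ℓ} (d∷ p) =
  ∈-++⁺ʳ (upFrom (suc y) ℓ) (∈-++⁺ˡ (∈-map⁺ d∷_ (∈-paths p)))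
∈-paths {y} {suc ℓ} (h∷ p) =
  ∈-++⁺ʳ (upFrom y ℓ) (∈-++⁺ʳ (downFrom y ℓ) (∈-map⁺ h∷_ (∈-paths p)))

paths-unique : ∀ y ℓ → Unique (paths y ℓ)
private
  downFrom-unique : ∀ y ℓ → Unique (downFrom y ℓ)
  levelFrom-unique : ∀ y ℓ → Unique (levelFrom y ℓ)

paths-unique y       (suc ℓ) =
  Unique.++⁺ (Unique.map⁺ (λ { refl → refl }) (paths-unique (suc y) ℓ))
    (Unique.++⁺ (downFrom-unique y ℓ) (levelFrom-unique y ℓ) (d≢h y ℓ))
    (λ { (p∈u , p∈) → u≢dh y ℓ p∈u (∈-++⁻ (downFrom y ℓ) p∈) })
  where
  d≢h : ∀ y ℓ {p : Path y (suc ℓ)} → p ∈ downFrom y ℓ × p ∈ levelFrom y ℓ → ⊥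
  d≢h (suc y) (suc ℓ) (p∈d , p∈h) with ∈-map⁻ d∷_ p∈d | ∈-map⁻ h∷_ p∈h
  ... | _ , _ , refl | _ , _ , ()
  u≢dh : ∀ y ℓ {p : Path y (suc ℓ)} → p ∈ upFrom y ℓ →
         p ∈ downFrom y ℓ ⊎ p ∈ levelFrom y ℓ → ⊥
  u≢dh y ℓ p∈u q with ∈-map⁻ u∷_ p∈u
  u≢dh (suc y) ℓ p∈u (inj₁ p∈d) | _ , _ , refl with ∈-map⁻ d∷_ p∈d
  ... | _ , _ , ()
  u≢dh y (suc ℓ) p∈u (inj₂ p∈h) | _ , _ , refl with ∈-map⁻ h∷_ p∈h
  ... | _ , _ , ()
paths-unique zero    zero    = [] ∷ []
paths-unique (suc y) zero    = []

downFrom-unique zero    ℓ = []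
downFrom-unique (suc y) ℓ = Unique.map⁺ (λ { refl → refl }) (paths-unique y ℓ)

levelFrom-unique y zero    = []
levelFrom-unique y (suc ℓ) = Unique.map⁺ (λ { refl → refl }) (paths-unique y ℓ)

all𝒫 : ∀ n → List (𝒫 n)
all𝒫 n = paths 0 (2 * n)

A134425 : ℕ → ℕ
A134425 n = List.sum (map (λ p → 4 ^ low p) (all𝒫 n))

A225887 : ℕ → ℕ
A225887 n = List.sum (map (λ p → 3 ^ low p) (all𝒫 n))

A114710 : ℕ → ℕ
A114710 n = length (filter (λ p → low p ≟ 0 ×-dec peaks₁ p ≟ 0) (all𝒫 n))

{-# OPTIONS --safe #-}

-- Expanding along the first row, det A_{n+1} = Σ_k (-a₀)^k a_{k+1} det A_{n-k}.  So if a(x) and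
-- t(x) are the generating functions of a₁, a₂, … and t₀, t₁, … and t = a (1 − a₀ x t) with a₀ = ±1,
-- then det A_{n+1} = (-a₀)^n t_n.  All nine formulas are such identities between power series.
-- They follow from S = 1 + x S + x S² and from the equations which the first return to the x-axis
-- gives for the path series.  The quadratic equation is obtained from the explicit formula for S_n
-- by Lagrange inversion: w = S − 1 satisfies w = x (1 + w) (2 + w), and the coefficients of S^m
-- given by Lagrange's formula satisfy the recurrence S^{m+1} = S^m + x S^{m+1} + x S^{m+2}.

module Submission where

open import Algebra.Bundles using (CommutativeRing)
import Algebra.Construct.Pointwise as Pointwise
import Algebra.Solver.Ring as RingSolver
open import Algebra.Solver.Ring.AlmostCommutativeRing
  using (fromCommutativeRing; _-Raw-AlmostCommutative⟶_)
open import Data.Bool.Base using (if_then_else_; true; false)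
open import Data.Fin.Base using (Fin; zero; suc; toℕ; fromℕ<; punchIn)
open import Data.Fin.Properties using (toℕ-fromℕ<; toℕ≤pred[n])
open import Data.Integer.Base as ℤ using (ℤ; +_; _*_; _^_; 0ℤ; 1ℤ; -1ℤ)
import Data.Integer.Properties as ℤ
open import Data.Integer.Tactic.RingSolver using (solve-∀)
open import Data.List.Base using (List; []; _∷_; _++_; map; filter; length)
open import Data.List.Properties using (map-++)
open import Data.Nat.Base as ℕ using (ℕ; zero; suc; _∸_; _≥_; s≤s)
open import Data.Nat.Combinatorics using (_C_; nCk+nC[k+1]≡[n+1]C[k+1])
import Data.Nat.ListAction as List
import Data.Nat.ListAction.Properties as List
import Data.Nat.Properties as ℕ
import Data.Nat.Tactic.RingSolver as ℕ
open import Data.Product.Base using (_×_; _,_)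
open import Data.Vec.Functional using (Vector)
open import Function.Base using (_$_)
open import Relation.Binary.PropositionalEquality as ≡ using (_≡_; _≗_; cong; cong₂)
open import Relation.Nullary.Decidable as Dec using (Dec; yes; no; does; _×-dec_)
open import Relation.Nullary.Negation using (¬_)
open import Relation.Unary using (Decidable)
open import Defs

import Algebra.Properties.Semiring.Sum ℕ.+-*-semiring as ℕΣ
import Algebra.Properties.Semiring.Sum ℤ.+-*-semiring as ℤΣ

-- Formal power series

Series : Set
Series = ℕ → ℤ

shift : Series → Series
shift f n = f (suc n)

infix  8 ⊝_
infixl 6 _⊕_
infixl 7 _⊛_

-- Writing the left factor as its constant term plus x times its shift makes the Cauchy product
-- structurally recursive in the index, so the ring laws need no finite sums.
_⊕_ _⊛_ : Series → Series → Series
(f ⊕ g) n = f n ℤ.+ g n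
(f ⊛ g) zero    = f 0 ℤ.* g 0
(f ⊛ g) (suc n) = f 0 ℤ.* g (suc n) ℤ.+ (shift f ⊛ g) n

⊝_ : Series → Series
(⊝ f) n = ℤ.- f n

const : ℤ → Series
const c zero    = c
const c (suc n) = 0ℤ

⊛-cong : ∀ {f f′ g g′} → f ≗ f′ → g ≗ g′ → f ⊛ g ≗ f′ ⊛ g′
⊛-cong p q zero    = cong₂ ℤ._*_ (p 0) (q 0)
⊛-cong p q (suc n) =
  cong₂ ℤ._+_ (cong₂ ℤ._*_ (p 0) (q (suc n))) (⊛-cong (λ k → p (suc k)) q n)

⊛-zeroˡ : ∀ f n → (const 0ℤ ⊛ f) n ≡ 0ℤ
⊛-zeroˡ f zero    = ≡.refl
⊛-zeroˡ f (suc n) = ≡.trans (ℤ.+-identityˡ _)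
  (≡.trans (⊛-cong {g = f} (λ { zero → ≡.refl ; (suc _) → ≡.refl }) (λ _ → ≡.refl) n) (⊛-zeroˡ f n))

const-⊛ : ∀ c f n → (const c ⊛ f) n ≡ c ℤ.* f n
const-⊛ c f zero    = ≡.refl
const-⊛ c f (suc n) = ≡.trans (cong (λ x → c ℤ.* f (suc n) ℤ.+ x) tail≡0) (ℤ.+-identityʳ _)
  where
  tail≡0 : (shift (const c) ⊛ f) n ≡ 0ℤ
  tail≡0 = ≡.trans (⊛-cong {g = f} (λ { zero → ≡.refl ; (suc _) → ≡.refl }) (λ _ → ≡.refl) n)
                   (⊛-zeroˡ f n)

⊛-distribʳ : ∀ h f g → (f ⊕ g) ⊛ h ≗ (f ⊛ h) ⊕ (g ⊛ h)
⊛-distribʳ h f g zero    = ℤ.*-distribʳ-+ (h 0) (f 0) (g 0)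
⊛-distribʳ h f g (suc n) = ≡.trans
  (cong (λ x → (f 0 ℤ.+ g 0) ℤ.* h (suc n) ℤ.+ x) (⊛-distribʳ h (shift f) (shift g) n))
  (rearrange (f 0) (g 0) (h (suc n)) _ _)
  where
  rearrange : ∀ a b c x y →
    (a ℤ.+ b) ℤ.* c ℤ.+ (x ℤ.+ y) ≡ a ℤ.* c ℤ.+ x ℤ.+ (b ℤ.* c ℤ.+ y)
  rearrange = solve-∀

⊛-scale : ∀ c f g n → ((λ k → c ℤ.* f k) ⊛ g) n ≡ c ℤ.* (f ⊛ g) n
⊛-scale c f g zero    = ℤ.*-assoc c (f 0) (g 0)
⊛-scale c f g (suc n) = ≡.trans
  (cong (λ x → c ℤ.* f 0 ℤ.* g (suc n) ℤ.+ x) (⊛-scale c (shift f) g n))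
  (rearrange c (f 0) (g (suc n)) _)
  where
  rearrange : ∀ c a b x → c ℤ.* a ℤ.* b ℤ.+ c ℤ.* x ≡ c ℤ.* (a ℤ.* b ℤ.+ x)
  rearrange = solve-∀

⊛-assoc : ∀ f g h → (f ⊛ g) ⊛ h ≗ f ⊛ (g ⊛ h)
⊛-assoc f g h zero    = ℤ.*-assoc (f 0) (g 0) (h 0)
⊛-assoc f g h (suc n) = begin
  f 0 ℤ.* g 0 ℤ.* h (suc n) ℤ.+ (((λ k → f 0 ℤ.* g (suc k)) ⊕ (shift f ⊛ g)) ⊛ h) n
    ≡⟨ cong (λ x → f 0 ℤ.* g 0 ℤ.* h (suc n) ℤ.+ x)
         (⊛-distribʳ h (λ k → f 0 ℤ.* g (suc k)) (shift f ⊛ g) n) ⟩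
  f 0 ℤ.* g 0 ℤ.* h (suc n) ℤ.+
    (((λ k → f 0 ℤ.* g (suc k)) ⊛ h) n ℤ.+ ((shift f ⊛ g) ⊛ h) n)
    ≡⟨ cong₂ (λ x y → f 0 ℤ.* g 0 ℤ.* h (suc n) ℤ.+ (x ℤ.+ y))
         (⊛-scale (f 0) (shift g) h n) (⊛-assoc (shift f) g h n) ⟩
  f 0 ℤ.* g 0 ℤ.* h (suc n) ℤ.+
    (f 0 ℤ.* (shift g ⊛ h) n ℤ.+ (shift f ⊛ (g ⊛ h)) n)
    ≡⟨ rearrange (f 0) (g 0) (h (suc n)) _ _ ⟩
  f 0 ℤ.* (g 0 ℤ.* h (suc n) ℤ.+ (shift g ⊛ h) n) ℤ.+ (shift f ⊛ (g ⊛ h)) n ∎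
  where
  open ≡.≡-Reasoning
  rearrange : ∀ a b c x y →
    a ℤ.* b ℤ.* c ℤ.+ (a ℤ.* x ℤ.+ y) ≡ a ℤ.* (b ℤ.* c ℤ.+ x) ℤ.+ y
  rearrange = solve-∀

-- The mirror image of the defining recursion, with the constant term split off the right factor;
-- commutativity comes from comparing the two.
⊛-sucʳ : ∀ f g n → (f ⊛ g) (suc n) ≡ f (suc n) ℤ.* g 0 ℤ.+ (f ⊛ shift g) n
⊛-sucʳ f g zero    = ℤ.+-comm (f 0 ℤ.* g 1) (f 1 ℤ.* g 0)
⊛-sucʳ f g (suc n) = ≡.trans
  (cong (λ x → f 0 ℤ.* g (suc (suc n)) ℤ.+ x) (⊛-sucʳ (shift f) g n))
  (rearrange (f 0 ℤ.* g (suc (suc n))) (f (suc (suc n)) ℤ.* g 0) _)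
  where
  rearrange : ∀ a b x → a ℤ.+ (b ℤ.+ x) ≡ b ℤ.+ (a ℤ.+ x)
  rearrange = solve-∀

⊛-comm : ∀ f g → f ⊛ g ≗ g ⊛ f
⊛-comm f g zero    = ℤ.*-comm (f 0) (g 0)
⊛-comm f g (suc n) = ≡.trans
  (cong₂ ℤ._+_ (ℤ.*-comm (f 0) (g (suc n))) (⊛-comm (shift f) g n))
  (≡.sym (⊛-sucʳ g f n))

⊛-identityˡ : ∀ f → const 1ℤ ⊛ f ≗ f
⊛-identityˡ f n = ≡.trans (const-⊛ 1ℤ f n) (ℤ.*-identityˡ (f n))

seriesRing : CommutativeRing _ _
seriesRing = record
  { Carrier = Series ; _≈_ = _≗_ ; _+_ = _⊕_ ; _*_ = _⊛_ ; -_ = ⊝_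
  ; 0# = λ _ → 0ℤ ; 1# = const 1ℤ
  ; isCommutativeRing = record
    { isRing = record
      { +-isAbelianGroup = Pointwise.isAbelianGroup ℕ ℤ.+-0-isAbelianGroup
      ; *-cong           = λ {f} {f′} {g} {g′} → ⊛-cong {f} {f′} {g} {g′}
      ; *-assoc          = ⊛-assoc
      ; *-identity       = ⊛-identityˡ , λ f n → ≡.trans (⊛-comm f (const 1ℤ) n) (⊛-identityˡ f n)
      ; distrib          = (λ h f g n → ≡.trans (⊛-comm h (f ⊕ g) n)
                              (≡.trans (⊛-distribʳ h f g n)
                                (cong₂ ℤ._+_ (⊛-comm f h n) (⊛-comm g h n))))
                         , ⊛-distribʳ
      }
    ; *-comm = ⊛-comm
    }
  }

open CommutativeRing seriesRing hiding (zero; _+_; _*_; -_)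
open import Algebra.Properties.CommutativeSemiring.Exp commutativeSemiring
  using (^-distrib-*) renaming (_^_ to _⊛^_)
import Algebra.Properties.CommutativeSemiring.Binomial commutativeSemiring as Binomial
open import Algebra.Properties.Group +-group using () renaming (∙-cancelʳ to +-cancelʳ)
open import Algebra.Properties.Semiring.Mult semiring using (×-assoc-*) renaming (_×_ to _⊠_)
import Algebra.Properties.Semiring.Sum semiring as Σ
import Relation.Binary.Reasoning.Setoid setoid as ≈

-- With the integers, embedded as constant series, for coefficients, the ring solver can calculate
-- with numerals such as 2 and 3.
constHom : CommutativeRing.rawRing ℤ.+-*-commutativeRing
             -Raw-AlmostCommutative⟶ fromCommutativeRing seriesRing
constHom = record
  { ⟦_⟧    = const
  ; +-homo = λ { a b zero → ≡.refl ; a b (suc n) → ≡.refl }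
  ; *-homo = λ { a b zero → ≡.refl
               ; a b (suc n) → ≡.sym (≡.trans (const-⊛ a (const b) (suc n)) (ℤ.*-zeroʳ a)) }
  ; -‿homo = λ { a zero → ≡.refl ; a (suc n) → ≡.refl }
  ; 0-homo = λ { zero → ≡.refl ; (suc n) → ≡.refl }
  ; 1-homo = λ _ → ≡.refl
  }

open RingSolver _ (fromCommutativeRing seriesRing) constHom
  (λ a b → Dec.dec⇒maybe
    (Dec.map′ (λ a≡b n → cong (λ c → const c n) a≡b) (λ a≈b → a≈b 0) (a ℤ.≟ b)))
  using (solve; con; _:=_; _:+_; _:*_; :-_)

X : Series
X zero    = 0ℤ
X (suc n) = const 1ℤ n

X-* : ∀ f n → (X ⊛ f) (suc n) ≡ f n
X-* f n = ≡.trans (ℤ.+-identityˡ _) (*-identityˡ f n)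

-- Identities containing `shift f` are proved after multiplication by x, where `X ⊛ shift f` becomes
-- `f` without its constant term.
X*-cancel : ∀ {f g} → X ⊛ f ≈ X ⊛ g → f ≈ g
X*-cancel {f} {g} Xf≈Xg n = ≡.trans (≡.sym (X-* f n)) (≡.trans (Xf≈Xg (suc n)) (X-* g n))

-- Adding a multiple of l ≈ r to an equation reduces it to a polynomial identity.
eliminate : ∀ c {l r f g} → l ≈ r → f ⊕ c ⊛ r ≈ g ⊕ c ⊛ l → f ≈ g
eliminate c {l} {r} {f} {g} l≈r eq =
  +-cancelʳ (c ⊛ r) f g (trans eq (+-congˡ {g} (*-congˡ {c} l≈r)))

-- Formal derivatives

∂ : Series → Series
∂ f n = + suc n ℤ.* f (suc n)

∂-cong : ∀ {f g} → f ≈ g → ∂ f ≈ ∂ g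
∂-cong f≈g n = cong (+ suc n ℤ.*_) (f≈g (suc n))

∂-+ : ∀ f g → ∂ (f ⊕ g) ≈ ∂ f ⊕ ∂ g
∂-+ f g n = ℤ.*-distribˡ-+ (+ suc n) (f (suc n)) (g (suc n))

∂-const : ∀ c f → ∂ (const c ⊛ f) ≈ const c ⊛ ∂ f
∂-const c f n = begin
  + suc n ℤ.* (const c ⊛ f) (suc n)  ≡⟨ cong (+ suc n ℤ.*_) (const-⊛ c f (suc n)) ⟩
  + suc n ℤ.* (c ℤ.* f (suc n))      ≡⟨ swap (+ suc n) c (f (suc n)) ⟩
  c ℤ.* ∂ f n                        ≡⟨ const-⊛ c (∂ f) n ⟨
  (const c ⊛ ∂ f) n                  ∎
  where
  open ≡.≡-Reasoning
  swap : ∀ a b c → a ℤ.* (b ℤ.* c) ≡ b ℤ.* (a ℤ.* c)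
  swap = solve-∀

∂-X : ∀ f → ∂ (X ⊛ f) ≈ f ⊕ X ⊛ ∂ f
∂-X f zero    = ≡.trans (cong (1ℤ ℤ.*_) (X-* f 0))
  (≡.trans (ℤ.*-identityˡ (f 0)) (≡.sym (ℤ.+-identityʳ (f 0))))
∂-X f (suc n) = begin
  + suc (suc n) ℤ.* (X ⊛ f) (suc (suc n))    ≡⟨ cong (+ suc (suc n) ℤ.*_) (X-* f (suc n)) ⟩
  (1ℤ ℤ.+ + suc n) ℤ.* f (suc n)             ≡⟨ expand (+ suc n) (f (suc n)) ⟩
  f (suc n) ℤ.+ ∂ f n                        ≡⟨ cong (λ x → f (suc n) ℤ.+ x) (X-* (∂ f) n) ⟨
  f (suc n) ℤ.+ (X ⊛ ∂ f) (suc n)            ∎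
  where
  open ≡.≡-Reasoning
  expand : ∀ a b → (1ℤ ℤ.+ a) ℤ.* b ≡ b ℤ.+ a ℤ.* b
  expand = solve-∀

-- The Leibniz rule for a linear factor is enough: `φ` is a product of two such factors, and
-- `power-1` applies it to 1 + X.
∂-linear : ∀ c f → ∂ ((const c ⊕ X) ⊛ f) ≈ f ⊕ (const c ⊕ X) ⊛ ∂ f
∂-linear c f = begin
  ∂ ((const c ⊕ X) ⊛ f)                     ≈⟨ ∂-cong (distribʳ f (const c) X) ⟩
  ∂ (const c ⊛ f ⊕ X ⊛ f)                   ≈⟨ ∂-+ (const c ⊛ f) (X ⊛ f) ⟩
  ∂ (const c ⊛ f) ⊕ ∂ (X ⊛ f)               ≈⟨ +-cong (∂-const c f) (∂-X f) ⟩
  const c ⊛ ∂ f ⊕ (f ⊕ X ⊛ ∂ f)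
    ≈⟨ solve 4 (λ c x f ∂f → c :* ∂f :+ (f :+ x :* ∂f) := f :+ (c :+ x) :* ∂f)
         refl (const c) X f (∂ f) ⟩
  f ⊕ (const c ⊕ X) ⊛ ∂ f                   ∎
  where open ≈

-- Schröder numbers

-- S(x) − 1 is the compositional inverse of w / φ(w), written in the variable X.
φ φ′ ψ : Series
φ  = (const 1ℤ ⊕ X) ⊛ (const (+ 2) ⊕ X)
φ′ = const (+ 3) ⊕ const (+ 2) ⊛ X
ψ  = const (+ 2) ⊕ ⊝ (X ⊛ X)

∂-φ* : ∀ f → ∂ (φ ⊛ f) ≈ φ′ ⊛ f ⊕ φ ⊛ ∂ f
∂-φ* f = begin
  ∂ (φ ⊛ f)
    ≈⟨ ∂-cong (*-assoc (const 1ℤ ⊕ X) (const (+ 2) ⊕ X) f) ⟩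
  ∂ ((const 1ℤ ⊕ X) ⊛ ((const (+ 2) ⊕ X) ⊛ f))
    ≈⟨ ∂-linear 1ℤ ((const (+ 2) ⊕ X) ⊛ f) ⟩
  (const (+ 2) ⊕ X) ⊛ f ⊕ (const 1ℤ ⊕ X) ⊛ ∂ ((const (+ 2) ⊕ X) ⊛ f)
    ≈⟨ +-congˡ {(const (+ 2) ⊕ X) ⊛ f} (*-congˡ {const 1ℤ ⊕ X} (∂-linear (+ 2) f)) ⟩
  (const (+ 2) ⊕ X) ⊛ f ⊕ (const 1ℤ ⊕ X) ⊛ (f ⊕ (const (+ 2) ⊕ X) ⊛ ∂ f)
    ≈⟨ solve 3 (λ x f ∂f →
         (con (+ 2) :+ x) :* f :+ (con 1ℤ :+ x) :* (f :+ (con (+ 2) :+ x) :* ∂f)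
           := (con (+ 3) :+ con (+ 2) :* x) :* f :+ (con 1ℤ :+ x) :* (con (+ 2) :+ x) :* ∂f)
         refl X f (∂ f) ⟩
  φ′ ⊛ f ⊕ φ ⊛ ∂ f ∎
  where open ≈

∂-φ^ : ∀ n → ∂ (φ ⊛^ suc n) ≈ const (+ suc n) ⊛ (φ′ ⊛ φ ⊛^ n)
∂-φ^ zero    = trans (∂-φ* 1#) (trans (+-congˡ {φ′ ⊛ 1#} (*-congˡ {φ} ∂1≈0))
  (solve 2 (λ p q → q :* con 1ℤ :+ p :* con 0ℤ := con 1ℤ :* (q :* con 1ℤ)) refl φ φ′))
  where
  ∂1≈0 : ∂ 1# ≈ const 0ℤ
  ∂1≈0 zero    = ≡.refl
  ∂1≈0 (suc n) = ℤ.*-zeroʳ (+ suc (suc n))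
∂-φ^ (suc n) = begin
  ∂ (φ ⊛ φ ⊛^ suc n)
    ≈⟨ ∂-φ* (φ ⊛^ suc n) ⟩
  φ′ ⊛ (φ ⊛ φ ⊛^ n) ⊕ φ ⊛ ∂ (φ ⊛^ suc n)
    ≈⟨ +-congˡ {φ′ ⊛ (φ ⊛ φ ⊛^ n)} (*-congˡ {φ} (∂-φ^ n)) ⟩
  φ′ ⊛ (φ ⊛ φ ⊛^ n) ⊕ φ ⊛ (const (+ suc n) ⊛ (φ′ ⊛ φ ⊛^ n))
    ≈⟨ solve 4 (λ p q r m → q :* (p :* r) :+ p :* (m :* (q :* r))
         := (con 1ℤ :+ m) :* (q :* (p :* r)))
         refl φ φ′ (φ ⊛^ n) (const (+ suc n)) ⟩
  (const 1ℤ ⊕ const (+ suc n)) ⊛ (φ′ ⊛ φ ⊛^ suc n)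
    ≈⟨ *-congʳ {φ′ ⊛ φ ⊛^ suc n} (λ { zero → ≡.refl ; (suc _) → ≡.refl }) ⟩
  const (+ suc (suc n)) ⊛ (φ′ ⊛ φ ⊛^ suc n) ∎
  where open ≈

-- The Lagrange–Bürmann coefficient extraction, with ψ = φ − X φ′.
lagrange : ∀ h n →
  + suc n ℤ.* (h ⊛ (φ ⊛^ n ⊛ ψ)) (suc n) ≡ (∂ (h ⊛ φ ⊛^ suc n) ⊕ ⊝ (h ⊛ ∂ (φ ⊛^ suc n))) n
lagrange h n = begin
  + suc n ℤ.* (h ⊛ (φ ⊛^ n ⊛ ψ)) (suc n)
    ≡⟨ cong (+ suc n ℤ.*_) (split (suc n)) ⟩
  + suc n ℤ.* ((h ⊛ φ ⊛^ suc n) (suc n) ℤ.+ ℤ.- (X ⊛ g) (suc n))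
    ≡⟨ cong (λ a → + suc n ℤ.* ((h ⊛ φ ⊛^ suc n) (suc n) ℤ.+ ℤ.- a)) (X-* g n) ⟩
  + suc n ℤ.* ((h ⊛ φ ⊛^ suc n) (suc n) ℤ.+ ℤ.- g n)
    ≡⟨ expand (+ suc n) ((h ⊛ φ ⊛^ suc n) (suc n)) (g n) ⟩
  ∂ (h ⊛ φ ⊛^ suc n) n ℤ.+ ℤ.- (+ suc n ℤ.* g n)
    ≡⟨ cong (λ a → ∂ (h ⊛ φ ⊛^ suc n) n ℤ.+ ℤ.- a) (const-⊛ (+ suc n) g n) ⟨
  ∂ (h ⊛ φ ⊛^ suc n) n ℤ.+ ℤ.- (const (+ suc n) ⊛ g) n
    ≡⟨ cong (λ a → ∂ (h ⊛ φ ⊛^ suc n) n ℤ.+ ℤ.- a) (derivative n) ⟩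
  (∂ (h ⊛ φ ⊛^ suc n) ⊕ ⊝ (h ⊛ ∂ (φ ⊛^ suc n))) n ∎
  where
  open ≡.≡-Reasoning
  g = h ⊛ (φ′ ⊛ φ ⊛^ n)
  split : h ⊛ (φ ⊛^ n ⊛ ψ) ≈ h ⊛ φ ⊛^ suc n ⊕ ⊝ (X ⊛ g)
  split = solve 3 (λ x h p →
    h :* (p :* (con (+ 2) :+ :- (x :* x)))
      := h :* ((con 1ℤ :+ x) :* (con (+ 2) :+ x) :* p)
           :+ :- (x :* (h :* ((con (+ 3) :+ con (+ 2) :* x) :* p)))) refl X h (φ ⊛^ n)
  expand : ∀ a b c → a ℤ.* (b ℤ.+ ℤ.- c) ≡ a ℤ.* b ℤ.+ ℤ.- (a ℤ.* c)
  expand = solve-∀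
  -- The factor n + 1 completes `φ′ ⊛ φ ⊛^ n` to the derivative of `φ ⊛^ suc n`. By the Leibniz rule
  -- the resulting difference is h′ φ^(n+1).
  derivative : const (+ suc n) ⊛ g ≈ h ⊛ ∂ (φ ⊛^ suc n)
  derivative = trans
    (solve 3 (λ m h q → m :* (h :* q) := h :* (m :* q)) refl (const (+ suc n)) h (φ′ ⊛ φ ⊛^ n))
    (*-congˡ {h} (sym {∂ (φ ⊛^ suc n)} (∂-φ^ n)))

-- Coefficients of the powers of `φ`

coeff-sum : ∀ {m} (t : Fin m → Series) n → Σ.sum t n ≡ ℤΣ.sum (λ i → t i n)
coeff-sum {zero}  t n = ≡.refl
coeff-sum {suc m} t n = cong (λ a → t zero n ℤ.+ a) (coeff-sum (λ i → t (suc i)) n)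

+-sum : ∀ {m} (t : Fin m → ℕ) → + ℕΣ.sum t ≡ ℤΣ.sum (λ i → + t i)
+-sum {zero}  t = ≡.refl
+-sum {suc m} t = cong (λ a → + t zero ℤ.+ a) (+-sum (λ i → t (suc i)))

coeff-⊠ : ∀ m f n → (m ⊠ f) n ≡ + m ℤ.* f n
coeff-⊠ zero    f n = ≡.refl
coeff-⊠ (suc m) f n = ≡.trans (cong (λ a → f n ℤ.+ a) (coeff-⊠ m f n)) (collect (+ m) (f n))
  where
  collect : ∀ a b → b ℤ.+ a ℤ.* b ≡ (1ℤ ℤ.+ a) ℤ.* b
  collect = solve-∀

const-^ : ∀ c n → const (+ c) ⊛^ n ≈ const (+ (c ℕ.^ n))
const-^ c zero    k = ≡.refl
const-^ c (suc n) k = ≡.trans (*-congˡ {const (+ c)} (const-^ c n) k)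
  (≡.trans (const-⊛ (+ c) _ k) (scale k))
  where
  scale : ∀ k → + c ℤ.* const (+ (c ℕ.^ n)) k ≡ const (+ (c ℕ.^ suc n)) k
  scale zero    = ≡.sym (ℤ.pos-* c (c ℕ.^ n))
  scale (suc k) = ℤ.*-zeroʳ (+ c)

coeff-X^* : ∀ e f j → (X ⊛^ e ⊛ f) (e ℕ.+ j) ≡ f j
coeff-X^* zero    f j = *-identityˡ f j
coeff-X^* (suc e) f j = ≡.trans (*-assoc X (X ⊛^ e) f (suc e ℕ.+ j))
  (≡.trans (X-* (X ⊛^ e ⊛ f) (e ℕ.+ j)) (coeff-X^* e f j))

-- Multiplication by 1 + X acts on coefficients as Pascal's rule.
coeff-[1+X]^ : ∀ m k → ((const 1ℤ ⊕ X) ⊛^ m) k ≡ + (m C k)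
coeff-[1+X]^ zero    zero    = ≡.refl
coeff-[1+X]^ zero    (suc k) = ≡.refl
coeff-[1+X]^ (suc m) zero    = ≡.trans (ℤ.*-identityˡ _) (coeff-[1+X]^ m 0)
coeff-[1+X]^ (suc m) (suc k) = begin
  ((const 1ℤ ⊕ X) ⊛ p) (suc k)             ≡⟨ distribʳ p (const 1ℤ) X (suc k) ⟩
  (const 1ℤ ⊛ p) (suc k) ℤ.+ (X ⊛ p) (suc k)
    ≡⟨ cong₂ ℤ._+_ (*-identityˡ p (suc k)) (X-* p k) ⟩
  p (suc k) ℤ.+ p k
    ≡⟨ cong₂ ℤ._+_ (coeff-[1+X]^ m (suc k)) (coeff-[1+X]^ m k) ⟩
  + (m C suc k ℕ.+ m C k)
    ≡⟨ cong +_ (≡.trans (ℕ.+-comm (m C suc k) (m C k)) (nCk+nC[k+1]≡[n+1]C[k+1] m k)) ⟩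
  + (suc m C suc k) ∎
  where
  open ≡.≡-Reasoning
  p = (const 1ℤ ⊕ X) ⊛^ m

-- In the binomial theorem 2^k comes with X^(n-k), so the coefficient at n reads `f` at n - (n - k)
-- = k.
coeff-[2+X]^* : ∀ n f →
  ((const (+ 2) ⊕ X) ⊛^ n ⊛ f) n ≡
  ℤΣ.sum {suc n} (λ k → + (2 ℕ.^ toℕ k ℕ.* (n C toℕ k)) ℤ.* f (toℕ k))
coeff-[2+X]^* n f = begin
  ((const (+ 2) ⊕ X) ⊛^ n ⊛ f) n
    ≡⟨ *-congʳ {f} (Binomial.theorem n (const (+ 2)) X) n ⟩
  (Binomial.binomialExpansion (const (+ 2)) X n ⊛ f) n
    ≡⟨ Σ.*-distribʳ-sum f (Binomial.binomialTerm (const (+ 2)) X n) n ⟩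
  Σ.sum (λ k → Binomial.binomialTerm (const (+ 2)) X n k ⊛ f) n
    ≡⟨ coeff-sum (λ k → Binomial.binomialTerm (const (+ 2)) X n k ⊛ f) n ⟩
  ℤΣ.sum (λ k → (Binomial.binomialTerm (const (+ 2)) X n k ⊛ f) n)
    ≡⟨ ℤΣ.sum-cong-≗ term ⟩
  ℤΣ.sum {suc n} (λ k → + (2 ℕ.^ toℕ k ℕ.* (n C toℕ k)) ℤ.* f (toℕ k)) ∎
  where
  open ≡.≡-Reasoning
  term : ∀ k → (Binomial.binomialTerm (const (+ 2)) X n k ⊛ f) n
             ≡ + (2 ℕ.^ toℕ k ℕ.* (n C toℕ k)) ℤ.* f (toℕ k)
  term k = begin
    ((n C j) ⊠ (const (+ 2) ⊛^ j ⊛ X ⊛^ e) ⊛ f) n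
      ≡⟨ ×-assoc-* (n C j) (const (+ 2) ⊛^ j ⊛ X ⊛^ e) f n ⟩
    ((n C j) ⊠ (const (+ 2) ⊛^ j ⊛ X ⊛^ e ⊛ f)) n
      ≡⟨ coeff-⊠ (n C j) (const (+ 2) ⊛^ j ⊛ X ⊛^ e ⊛ f) n ⟩
    + (n C j) ℤ.* (const (+ 2) ⊛^ j ⊛ X ⊛^ e ⊛ f) n
      ≡⟨ cong (+ (n C j) ℤ.*_) (*-assoc (const (+ 2) ⊛^ j) (X ⊛^ e) f n) ⟩
    + (n C j) ℤ.* (const (+ 2) ⊛^ j ⊛ (X ⊛^ e ⊛ f)) n
      ≡⟨ cong (+ (n C j) ℤ.*_) (*-congʳ {X ⊛^ e ⊛ f} (const-^ 2 j) n) ⟩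
    + (n C j) ℤ.* (const (+ (2 ℕ.^ j)) ⊛ (X ⊛^ e ⊛ f)) n
      ≡⟨ cong (+ (n C j) ℤ.*_) (const-⊛ (+ (2 ℕ.^ j)) (X ⊛^ e ⊛ f) n) ⟩
    + (n C j) ℤ.* (+ (2 ℕ.^ j) ℤ.* (X ⊛^ e ⊛ f) n)
      ≡⟨ regroup (+ (n C j)) (+ (2 ℕ.^ j)) ((X ⊛^ e ⊛ f) n) ⟩
    + (2 ℕ.^ j) ℤ.* + (n C j) ℤ.* (X ⊛^ e ⊛ f) n
      ≡⟨ cong₂ ℤ._*_ (≡.sym (ℤ.pos-* (2 ℕ.^ j) (n C j)))
           (≡.trans (cong (X ⊛^ e ⊛ f) (≡.sym (ℕ.m∸n+n≡m (toℕ≤pred[n] k)))) (coeff-X^* e f j)) ⟩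
    + (2 ℕ.^ j ℕ.* (n C j)) ℤ.* f j ∎
    where
    j = toℕ k
    e = n ∸ j
    regroup : ∀ a b c → a ℤ.* (b ℤ.* c) ≡ b ℤ.* a ℤ.* c
    regroup = solve-∀

-- Let n = m + 1. An extra factor X moves the coefficient to index n, as the expansion of (2 + X)^n
-- requires. The term k then pairs 2^k C(n,k) with C(n,k-1), and the term k = 0 vanishes because X
-- (1 + X)^n has no constant term.
coeff-φ^ : ∀ m → (φ ⊛^ suc m) m ≡ + schröderSum (suc m)
coeff-φ^ m = begin
  (φ ⊛^ n) m                                      ≡⟨ X-* (φ ⊛^ n) m ⟨
  (X ⊛ φ ⊛^ n) n                                  ≡⟨ reorder n ⟩
  ((const (+ 2) ⊕ X) ⊛^ n ⊛ f) n                  ≡⟨ coeff-[2+X]^* n f ⟩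
  + (2 ℕ.^ 0 ℕ.* (n C 0)) ℤ.* f 0 ℤ.+
    ℤΣ.sum {n} (λ i → + (2 ℕ.^ suc (toℕ i) ℕ.* (n C suc (toℕ i))) ℤ.* f (suc (toℕ i)))
    ≡⟨ cong₂ ℤ._+_ (ℤ.*-zeroʳ (+ (2 ℕ.^ 0 ℕ.* (n C 0)))) (ℤΣ.sum-cong-≗ {n} term) ⟩
  0ℤ ℤ.+ ℤΣ.sum {n} (λ i → + schröderTerm n (toℕ i)) ≡⟨ ℤ.+-identityˡ _ ⟩
  ℤΣ.sum {n} (λ i → + schröderTerm n (toℕ i))    ≡⟨ +-sum {n} (λ i → schröderTerm n (toℕ i)) ⟨
  + schröderSum n                                ∎
  where
  open ≡.≡-Reasoning
  n = suc m
  f = X ⊛ (const 1ℤ ⊕ X) ⊛^ n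
  reorder : X ⊛ φ ⊛^ n ≈ (const (+ 2) ⊕ X) ⊛^ n ⊛ f
  reorder = trans
    (*-congˡ {X} (^-distrib-* (const 1ℤ ⊕ X) (const (+ 2) ⊕ X) n))
    (solve 3 (λ x a b → x :* (a :* b) := b :* (x :* a))
      refl X ((const 1ℤ ⊕ X) ⊛^ n) ((const (+ 2) ⊕ X) ⊛^ n))
  term : ∀ i → + (2 ℕ.^ suc (toℕ i) ℕ.* (n C suc (toℕ i))) ℤ.* f (suc (toℕ i))
             ≡ + schröderTerm n (toℕ i)
  term i = begin
    + (p ℕ.* q) ℤ.* f (suc k)
      ≡⟨ cong (+ (p ℕ.* q) ℤ.*_) (≡.trans (X-* ((const 1ℤ ⊕ X) ⊛^ n) k) (coeff-[1+X]^ n k)) ⟩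
    + (p ℕ.* q) ℤ.* + (n C k)     ≡⟨ ℤ.pos-* (p ℕ.* q) (n C k) ⟨
    + (p ℕ.* q ℕ.* (n C k))       ≡⟨ cong +_ (ℕ.*-assoc p q (n C k)) ⟩
    + schröderTerm n k            ∎
    where
    k = toℕ i
    p = 2 ℕ.^ suc k
    q = n C suc k

-- Multiplying S = 1 + x S + x S² by U₀ S^y shows that U₀ S^y is such a family. Both the Lagrange
-- coefficients and the series of paths starting at height y will be recognised as families of this
-- form.
record IsFirstPassage (U : ℕ → Series) : Set where
  constructor firstPassage
  field step : ∀ y → U (suc y) ≈ U y ⊕ X ⊛ (U (suc y) ⊕ U (suc (suc y)))

-- The coefficient at n of `U (suc y)` depends on that of `U y` at n and, at n - 1, on those of the
-- indices y + 1 and y + 2. Induction on n, and then on y, therefore recovers everything from `U 0`.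
firstPassage-unique : ∀ {U V} → IsFirstPassage U → IsFirstPassage V → U 0 ≈ V 0 →
  ∀ n y → U y n ≡ V y n
firstPassage-unique {U} {V} pU pV U₀≈V₀ = go
  where
  open IsFirstPassage
  go : ∀ n y → U y n ≡ V y n
  go n       zero    = U₀≈V₀ n
  go zero    (suc y) = ≡.trans (step pU y 0)
    (≡.trans (cong (ℤ._+ 0ℤ) (go 0 y)) (≡.sym (step pV y 0)))
  go (suc n) (suc y) = ≡.trans (unfold U pU)
    (≡.trans (cong₂ ℤ._+_ (go (suc n) y) (cong₂ ℤ._+_ (go n (suc y)) (go n (suc (suc y)))))
             (≡.sym (unfold V pV)))
    where
    unfold : ∀ W → IsFirstPassage W →
      W (suc y) (suc n) ≡ W y (suc n) ℤ.+ (W (suc y) n ℤ.+ W (suc (suc y)) n)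
    unfold W pW = ≡.trans (step pW y (suc n))
      (cong (λ a → W y (suc n) ℤ.+ a) (X-* (W (suc y) ⊕ W (suc (suc y))) n))

firstPassage-shift : ∀ {U} → IsFirstPassage U → IsFirstPassage (λ y → U (suc y))
firstPassage-shift (firstPassage step) = firstPassage λ y → step (suc y)

firstPassage-scale : ∀ f {U} → IsFirstPassage U → IsFirstPassage (λ y → f ⊛ U y)
firstPassage-scale f {U} (firstPassage step) = firstPassage λ y → trans (*-congˡ {f} (step y))
  (solve 5 (λ x f u v w → f :* (u :+ x :* (v :+ w)) := f :* u :+ x :* (f :* v :+ f :* w))
    refl X f (U y) (U (suc y)) (U (suc (suc y))))

-- [X^n] S(X)^m = [X^n] (1 + X)^m φ^n (1 − X φ′ / φ), by Lagrange inversion.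
power : ℕ → Series
power m zero    = 1ℤ
power m (suc n) = ((const 1ℤ ⊕ X) ⊛^ m ⊛ (φ ⊛^ n ⊛ ψ)) (suc n)

-- Splitting one factor 1 + X gives `power m` plus x times a remainder. In the remainder a factor
-- `φ` = (1 + X) + (1 + X)² is spent, which lowers n by one and raises m by one or by two.
power-firstPassage : IsFirstPassage power
power-firstPassage = firstPassage λ
  { m zero    → ≡.refl
  ; m (suc n) → ≡.trans (split m n) (cong (λ a → power m (suc n) ℤ.+ a)
      (≡.sym (X-* (power (suc m) ⊕ power (suc (suc m))) n)))
  }
  where
  next : ∀ m n → ((const 1ℤ ⊕ X) ⊛^ m ⊛ (φ ⊛^ n ⊛ ψ)) n
               ≡ power (suc m) n ℤ.+ power (suc (suc m)) n
  -- Here no factor `φ` is left to spend; the constant term 2 of `ψ` supplies the sum 1 + 1.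
  next m zero    = cong (ℤ._* (+ 2)) (coeff-[1+X]^ m 0)
  next m (suc n) = solve 3 (λ x h p →
    h :* ((con 1ℤ :+ x) :* (con (+ 2) :+ x) :* p :* (con (+ 2) :+ :- (x :* x)))
      := (con 1ℤ :+ x) :* h :* (p :* (con (+ 2) :+ :- (x :* x)))
           :+ (con 1ℤ :+ x) :* ((con 1ℤ :+ x) :* h) :* (p :* (con (+ 2) :+ :- (x :* x))))
    refl X ((const 1ℤ ⊕ X) ⊛^ m) (φ ⊛^ n) (suc n)
  split : ∀ m n → power (suc m) (suc n)
                ≡ power m (suc n) ℤ.+ (power (suc m) n ℤ.+ power (suc (suc m)) n)
  split m n = ≡.trans
    (solve 3 (λ x h q → (con 1ℤ :+ x) :* h :* q := h :* q :+ x :* (h :* q))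
      refl X ((const 1ℤ ⊕ X) ⊛^ m) (φ ⊛^ n ⊛ ψ) (suc n))
    (cong (λ a → power m (suc n) ℤ.+ a)
      (≡.trans (X-* ((const 1ℤ ⊕ X) ⊛^ m ⊛ (φ ⊛^ n ⊛ ψ)) n) (next m n)))

-- For h = 1 the two derivatives in `lagrange` cancel, and the factor n + 1 can be divided out.
power-0 : power 0 ≈ 1#
power-0 zero    = ≡.refl
power-0 (suc n) = ℤ.*-cancelˡ-≡ (+ suc n) (power 0 (suc n)) 0ℤ (begin
  + suc n ℤ.* power 0 (suc n)              ≡⟨ lagrange 1# n ⟩
  (∂ (1# ⊛ φ ⊛^ suc n) ⊕ ⊝ (1# ⊛ ∂ (φ ⊛^ suc n))) n
    ≡⟨ cong₂ (λ a b → a ℤ.+ ℤ.- b) (∂-cong (*-identityˡ (φ ⊛^ suc n)) n)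
         (*-identityˡ (∂ (φ ⊛^ suc n)) n) ⟩
  (∂ (φ ⊛^ suc n) ⊕ ⊝ ∂ (φ ⊛^ suc n)) n    ≡⟨ -‿inverseʳ (∂ (φ ⊛^ suc n)) n ⟩
  0ℤ                                       ≡⟨ ℤ.*-zeroʳ (+ suc n) ⟨
  + suc n ℤ.* 0ℤ                           ∎)
  where open ≡.≡-Reasoning

𝕊 𝕤 : Series
𝕊 n = + S n
𝕤 n = + s n

-- For h = 1 + X the difference in `lagrange` is φ^(n+1), whose coefficient at n is the explicit
-- Schröder sum. This is where the closed formula enters.
power-1 : power 1 ≈ 𝕊
power-1 zero    = ≡.refl
power-1 (suc n) = ℤ.*-cancelˡ-≡ (+ suc n) (power 1 (suc n)) (𝕊 (suc n)) (begin
  + suc n ℤ.* power 1 (suc n)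
    ≡⟨ lagrange ((const 1ℤ ⊕ X) ⊛^ 1) n ⟩
  (∂ ((const 1ℤ ⊕ X) ⊛^ 1 ⊛ p) ⊕ ⊝ ((const 1ℤ ⊕ X) ⊛^ 1 ⊛ ∂ p)) n
    ≡⟨ +-cong (∂-cong (*-congʳ {p} (*-identityʳ (const 1ℤ ⊕ X))))
              (-‿cong (*-congʳ {∂ p} (*-identityʳ (const 1ℤ ⊕ X)))) n ⟩
  (∂ ((const 1ℤ ⊕ X) ⊛ p) ⊕ ⊝ ((const 1ℤ ⊕ X) ⊛ ∂ p)) n
    ≡⟨ +-congʳ { ⊝ ((const 1ℤ ⊕ X) ⊛ ∂ p)} (∂-linear 1ℤ p) n ⟩
  (p ⊕ (const 1ℤ ⊕ X) ⊛ ∂ p ⊕ ⊝ ((const 1ℤ ⊕ X) ⊛ ∂ p)) n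
    ≡⟨ solve 3 (λ p q d → p :+ q :* d :+ :- (q :* d) := p) refl p (const 1ℤ ⊕ X) (∂ p) n ⟩
  p n
    ≡⟨ coeff-φ^ n ⟩
  + schröderSum (suc n)
    ≡⟨ cong +_ (n*S≡schröderSum n) ⟨
  + (suc n ℕ.* S (suc n))
    ≡⟨ ℤ.pos-* (suc n) (S (suc n)) ⟩
  + suc n ℤ.* 𝕊 (suc n) ∎)
  where
  open ≡.≡-Reasoning
  p = φ ⊛^ suc n

-- `U 0` times the family `power` starts with the same series, so uniqueness applies. For paths this
-- is the factorization at the first arrival on the axis.
firstPassage-1 : ∀ {U} → IsFirstPassage U → U 1 ≈ U 0 ⊛ 𝕊
firstPassage-1 {U} pU n = ≡.trans
  (firstPassage-unique pU (firstPassage-scale (U 0) power-firstPassage)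
    (λ k → ≡.sym (≡.trans (*-congˡ {U 0} power-0 k) (*-identityʳ (U 0) k))) n 1)
  (*-congˡ {U 0} power-1 n)

-- The family `power` started at index 1 shows that `power 2` is S²; the recurrence at 0 is then the
-- quadratic equation.
𝕊-quadratic : 𝕊 ≈ const 1ℤ ⊕ X ⊛ (𝕊 ⊕ 𝕊 ⊛ 𝕊)
𝕊-quadratic = begin
  𝕊                                 ≈⟨ power-1 ⟨
  power 1                           ≈⟨ IsFirstPassage.step power-firstPassage 0 ⟩
  power 0 ⊕ X ⊛ (power 1 ⊕ power 2)
    ≈⟨ +-cong power-0 (*-congˡ {X} (+-cong power-1
         (trans (firstPassage-1 (firstPassage-shift power-firstPassage)) (*-congʳ {𝕊} power-1)))) ⟩
  const 1ℤ ⊕ X ⊛ (𝕊 ⊕ 𝕊 ⊛ 𝕊)        ∎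
  where open ≈

-- The 1 corrects the constant term: small numbers are half the large ones only from index 1 on,
-- while both start with 1.
2𝕤≈1+𝕊 : const (+ 2) ⊛ 𝕤 ≈ const 1ℤ ⊕ 𝕊
2𝕤≈1+𝕊 zero    = ≡.refl
2𝕤≈1+𝕊 (suc n) = begin
  (const (+ 2) ⊛ 𝕤) (suc n)   ≡⟨ const-⊛ (+ 2) 𝕤 (suc n) ⟩
  + 2 ℤ.* + s (suc n)         ≡⟨ ℤ.pos-* 2 (s (suc n)) ⟨
  + (2 ℕ.* s (suc n))         ≡⟨ cong +_ (2*s≡S n) ⟩
  + S (suc n)                 ≡⟨ ℤ.+-identityˡ (+ S (suc n)) ⟨
  0ℤ ℤ.+ + S (suc n)          ∎
  where open ≡.≡-Reasoning

2*-cancel : ∀ {f g} → const (+ 2) ⊛ f ≈ const (+ 2) ⊛ g → f ≈ g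
2*-cancel {f} {g} 2f≈2g n = ℤ.*-cancelˡ-≡ (+ 2) (f n) (g n)
  (≡.trans (≡.sym (const-⊛ (+ 2) f n)) (≡.trans (2f≈2g n) (const-⊛ (+ 2) g n)))

𝕊≈2𝕤-1 : 𝕊 ≈ const (+ 2) ⊛ 𝕤 ⊕ ⊝ const 1ℤ
𝕊≈2𝕤-1 = eliminate (⊝ const 1ℤ) 2𝕤≈1+𝕊
  (solve 2 (λ s S →
    S :+ :- con 1ℤ :* (con 1ℤ :+ S)
      := con (+ 2) :* s :+ :- con 1ℤ :+ :- con 1ℤ :* (con (+ 2) :* s))
    refl 𝕤 𝕊)

-- Hessenberg–Toeplitz determinants

det-cong : ∀ {n} {M N : Matrix n} → (∀ i j → M i j ≡ N i j) → det M ≡ det N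
det-cong {zero}  M≡N = ≡.refl
det-cong {suc n} M≡N = ℤΣ.sum-cong-≗ λ j →
  cong₂ (λ a b → -1ℤ ℤ.^ toℕ j ℤ.* a ℤ.* b) (M≡N zero j)
        (det-cong (λ k l → M≡N (suc k) (punchIn j l)))

-- With natural indices and recursion along diagonals, deleting the first row and column gives back
-- the same matrix by computation, without bounds on the indices.
toeplitz : ℤ → Series → ℕ → ℕ → ℤ
toeplitz a₀ a i       zero          = a i
toeplitz a₀ a zero    (suc zero)    = a₀
toeplitz a₀ a zero    (suc (suc j)) = 0ℤ
toeplitz a₀ a (suc i) (suc j)       = toeplitz a₀ a i j

-- An independent first column b is what the Laplace expansion needs: deleting the first row and
-- the second column shifts b and leaves the other columns Toeplitz.
hessenberg : ℤ → Series → Series → ℕ → ℕ → ℤ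
hessenberg a₀ a b i zero    = b i
hessenberg a₀ a b i (suc j) = toeplitz a₀ a i (suc j)

if-if : ∀ {p q} {P : Set p} {Q : Set q} (P? : Dec P) (Q? : Dec Q) {x y z r : ℤ} →
  (P → x ≡ r) → (Q → y ≡ r) → (¬ P → ¬ Q → z ≡ r) →
  (if does P? then x else if does Q? then y else z) ≡ r
if-if (yes p) Q?      x≡r y≡r z≡r = x≡r p
if-if (no ¬p) (yes q) x≡r y≡r z≡r = y≡r q
if-if (no ¬p) (no ¬q) x≡r y≡r z≡r = z≡r ¬p ¬q

A≡toeplitz : ∀ {n} a₀ a (v : Vector ℤ n) → (∀ k → v k ≡ a (toℕ k)) →
             ∀ i j → A a₀ v i j ≡ toeplitz a₀ a (toℕ i) (toℕ j)
A≡toeplitz a₀ a v v≡a i j = if-if (toℕ j ℕ.≤? toℕ i) (toℕ j ℕ.≟ suc (toℕ i))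
  (λ j≤i → ≡.trans (v≡a _) (≡.trans (cong a (toℕ-fromℕ< _)) (below (toℕ i) (toℕ j) j≤i)))
  (λ j≡1+i → ≡.trans (on (toℕ i)) (cong (toeplitz a₀ a (toℕ i)) (≡.sym j≡1+i)))
  (λ j≰i j≢1+i → above (toℕ i) (toℕ j) (ℕ.≤∧≢⇒< (ℕ.≰⇒> j≰i) (λ e → j≢1+i (≡.sym e))))
  where
  below : ∀ i j → j ℕ.≤ i → a (i ∸ j) ≡ toeplitz a₀ a i j
  below i       zero    _            = ≡.refl
  below (suc i) (suc j) (ℕ.s≤s j≤i) = below i j j≤i
  on : ∀ i → a₀ ≡ toeplitz a₀ a i (suc i)
  on zero    = ≡.refl
  on (suc i) = on i
  above : ∀ i j → suc i ℕ.< j → 0ℤ ≡ toeplitz a₀ a i j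
  above zero    (suc zero)    (ℕ.s≤s ())
  above zero    (suc (suc j)) _           = ≡.refl
  above (suc i) (suc j)       (ℕ.s≤s i<j) = above i j i<j

toeplitzDet : ℤ → Series → ℕ → ℤ
toeplitzDet a₀ a n = det {n} (λ i j → toeplitz a₀ a (toℕ i) (toℕ j))

hessenbergDet : ℤ → Series → Series → ℕ → ℤ
hessenbergDet a₀ a b n = det {n} (λ i j → hessenberg a₀ a b (toℕ i) (toℕ j))

hessenbergDet-diag : ∀ a₀ a n → hessenbergDet a₀ a a n ≡ toeplitzDet a₀ a n
hessenbergDet-diag a₀ a n = det-cong {n} λ i j → same (toℕ i) (toℕ j)
  where
  same : ∀ i j → hessenberg a₀ a a i j ≡ toeplitz a₀ a i j
  same i zero    = ≡.refl
  same i (suc j) = ≡.refl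

-- Only the first two entries of the first row, `b 0` and `a₀`, survive in the Laplace expansion.
hessenbergDet-suc : ∀ a₀ a b n → hessenbergDet a₀ a b (suc (suc n)) ≡
  b 0 ℤ.* toeplitzDet a₀ a (suc n) ℤ.+ ℤ.- a₀ ℤ.* hessenbergDet a₀ a (shift b) (suc n)
hessenbergDet-suc a₀ a b n = begin
  1ℤ ℤ.* b 0 ℤ.* t ℤ.+ (-1ℤ ℤ.^ 1 ℤ.* a₀ ℤ.* det (minor M zero (suc zero)) ℤ.+ rest)
    ≡⟨ cong₂ (λ x y → 1ℤ ℤ.* b 0 ℤ.* t ℤ.+ (-1ℤ ℤ.^ 1 ℤ.* a₀ ℤ.* x ℤ.+ y))
         (det-cong {suc n} second) (≡.trans (ℤΣ.sum-cong-≗ vanish) (ℤΣ.sum-replicate-zero n)) ⟩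
  1ℤ ℤ.* b 0 ℤ.* t ℤ.+ (-1ℤ ℤ.^ 1 ℤ.* a₀ ℤ.* h ℤ.+ 0ℤ)
    ≡⟨ simplify (b 0) t a₀ h ⟩
  b 0 ℤ.* t ℤ.+ ℤ.- a₀ ℤ.* h ∎
  where
  open ≡.≡-Reasoning
  M : Matrix (suc (suc n))
  M i j = hessenberg a₀ a b (toℕ i) (toℕ j)
  t = toeplitzDet a₀ a (suc n)
  h = hessenbergDet a₀ a (shift b) (suc n)
  summand : Fin n → ℤ
  summand j = -1ℤ ℤ.^ suc (suc (toℕ j)) ℤ.* 0ℤ ℤ.* det (minor M zero (suc (suc j)))
  rest = ℤΣ.sum summand
  second : ∀ k l → minor M zero (suc zero) k l ≡ hessenberg a₀ a (shift b) (toℕ k) (toℕ l)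
  second k zero    = ≡.refl
  second k (suc l) = ≡.refl
  vanish : ∀ j → summand j ≡ 0ℤ
  vanish j = cong (ℤ._* det (minor M zero (suc (suc j)))) (ℤ.*-zeroʳ (-1ℤ ℤ.^ suc (suc (toℕ j))))
  simplify : ∀ b t a h →
    1ℤ ℤ.* b ℤ.* t ℤ.+ (-1ℤ ℤ.* 1ℤ ℤ.* a ℤ.* h ℤ.+ 0ℤ) ≡ b ℤ.* t ℤ.+ ℤ.- a ℤ.* h
  simplify = solve-∀

-- This is the substitution of δx for x; it absorbs the powers of -a₀ that pile up in the expansion.
twist : ℤ → Series → Series
twist δ f n = δ ℤ.^ n ℤ.* f n

shift-twist-* : ∀ δ f g n → (shift (twist δ f) ⊛ g) n ≡ δ ℤ.* (twist δ (shift f) ⊛ g) n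
shift-twist-* δ f g n = ≡.trans
  (*-congʳ {g} (λ k → ℤ.*-assoc δ (δ ℤ.^ k) (f (suc k))) n)
  (⊛-scale δ (twist δ (shift f)) g n)

twist-* : ∀ δ f g → twist δ (f ⊛ g) ≈ twist δ f ⊛ twist δ g
twist-* δ f g zero    = unit (f 0) (g 0)
  where
  unit : ∀ a b → 1ℤ ℤ.* (a ℤ.* b) ≡ 1ℤ ℤ.* a ℤ.* (1ℤ ℤ.* b)
  unit = solve-∀
twist-* δ f g (suc n) = begin
  δ ℤ.* p ℤ.* (f 0 ℤ.* g (suc n) ℤ.+ q)                  ≡⟨ rearrange δ p (f 0) (g (suc n)) q ⟩
  1ℤ ℤ.* f 0 ℤ.* twist δ g (suc n) ℤ.+ δ ℤ.* (p ℤ.* q)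
    ≡⟨ cong (λ x → 1ℤ ℤ.* f 0 ℤ.* twist δ g (suc n) ℤ.+ x)
         (≡.trans (cong (δ ℤ.*_) (twist-* δ (shift f) g n))
                  (≡.sym (shift-twist-* δ f (twist δ g) n))) ⟩
  (twist δ f ⊛ twist δ g) (suc n) ∎
  where
  open ≡.≡-Reasoning
  p = δ ℤ.^ n
  q = (shift f ⊛ g) n
  rearrange : ∀ d p a b q →
    d ℤ.* p ℤ.* (a ℤ.* b ℤ.+ q) ≡ 1ℤ ℤ.* a ℤ.* (d ℤ.* p ℤ.* b) ℤ.+ d ℤ.* (p ℤ.* q)
  rearrange = solve-∀

-- Each further expansion shifts the first column and contributes a factor -a₀, so the accumulated
-- sum is a convolution.
hessenbergDet-series : ∀ a₀ a b n →
  hessenbergDet a₀ a b (suc n) ≡ (twist (ℤ.- a₀) b ⊛ toeplitzDet a₀ a) n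
hessenbergDet-series a₀ a b zero    = ℤ.+-identityʳ _
hessenbergDet-series a₀ a b (suc n) = begin
  hessenbergDet a₀ a b (suc (suc n))
    ≡⟨ hessenbergDet-suc a₀ a b n ⟩
  b 0 ℤ.* t ℤ.+ ℤ.- a₀ ℤ.* hessenbergDet a₀ a (shift b) (suc n)
    ≡⟨ cong₂ (λ x y → x ℤ.* t ℤ.+ ℤ.- a₀ ℤ.* y) (≡.sym (ℤ.*-identityˡ (b 0)))
         (hessenbergDet-series a₀ a (shift b) n) ⟩
  1ℤ ℤ.* b 0 ℤ.* t ℤ.+ ℤ.- a₀ ℤ.* (twist (ℤ.- a₀) (shift b) ⊛ toeplitzDet a₀ a) n
    ≡⟨ cong (λ x → 1ℤ ℤ.* b 0 ℤ.* t ℤ.+ x) (shift-twist-* (ℤ.- a₀) b (toeplitzDet a₀ a) n) ⟨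
  (twist (ℤ.- a₀) b ⊛ toeplitzDet a₀ a) (suc n) ∎
  where
  open ≡.≡-Reasoning
  t = toeplitzDet a₀ a (suc n)

toeplitzDet-series : ∀ a₀ a →
  toeplitzDet a₀ a ≈ const 1ℤ ⊕ X ⊛ (twist (ℤ.- a₀) a ⊛ toeplitzDet a₀ a)
toeplitzDet-series a₀ a zero    = ≡.refl
toeplitzDet-series a₀ a (suc n) = begin
  toeplitzDet a₀ a (suc n)                          ≡⟨ hessenbergDet-diag a₀ a (suc n) ⟨
  hessenbergDet a₀ a a (suc n)                      ≡⟨ hessenbergDet-series a₀ a a n ⟩
  (twist (ℤ.- a₀) a ⊛ toeplitzDet a₀ a) n           ≡⟨ X-* (twist (ℤ.- a₀) a ⊛ toeplitzDet a₀ a) n ⟨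
  (X ⊛ (twist (ℤ.- a₀) a ⊛ toeplitzDet a₀ a)) (suc n) ≡⟨ ℤ.+-identityˡ _ ⟨
  (const 1ℤ ⊕ X ⊛ (twist (ℤ.- a₀) a ⊛ toeplitzDet a₀ a)) (suc n) ∎
  where open ≡.≡-Reasoning

-- Both series are inverses of 1 - x h. Multiplying each equation by the other series gives f = f g
-- (1 - x h) = g.
fixpoint-unique : ∀ h {f g} → f ≈ const 1ℤ ⊕ X ⊛ (h ⊛ f) → g ≈ const 1ℤ ⊕ X ⊛ (h ⊛ g) → f ≈ g
fixpoint-unique h {f} {g} f-eq g-eq = eliminate g f-eq (eliminate (⊝ f) g-eq
  (solve 4 (λ x h f g →
    f :+ g :* (con 1ℤ :+ x :* (h :* f)) :+ :- f :* (con 1ℤ :+ x :* (h :* g))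
      := g :+ g :* f :+ :- f :* g) refl X h f g))

-- Put δ = -a₀. Replacing x by δx in the equation for t turns δ x t into δ² x t(δx) = x t(δx). Hence
-- 1 + x t(δx) satisfies the fixpoint equation of the determinants, and its coefficient at n + 1 is
-- δ^n t_n.
toeplitzDet-solution : ∀ a₀ → ℤ.- a₀ ℤ.* ℤ.- a₀ ≡ 1ℤ → ∀ a t →
  t ≈ a ⊛ (const 1ℤ ⊕ const (ℤ.- a₀) ⊛ (X ⊛ t)) →
  ∀ n → toeplitzDet a₀ a (suc n) ≡ (ℤ.- a₀) ℤ.^ n ℤ.* t n
toeplitzDet-solution a₀ δ²≡1 a t t-eq n = ≡.trans
  (fixpoint-unique (twist δ a) (toeplitzDet-series a₀ a) solution (suc n))
  (≡.trans (ℤ.+-identityˡ _) (X-* (twist δ t) n))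
  where
  δ = ℤ.- a₀
  twist-1+δX : twist δ (const 1ℤ ⊕ const δ ⊛ (X ⊛ t)) ≈ const 1ℤ ⊕ X ⊛ twist δ t
  twist-1+δX zero    = cong (λ x → 1ℤ ℤ.* (1ℤ ℤ.+ x)) (ℤ.*-zeroʳ δ)
  twist-1+δX (suc k) = begin
    δ ℤ.* p ℤ.* (0ℤ ℤ.+ (const δ ⊛ (X ⊛ t)) (suc k))
      ≡⟨ cong (λ x → δ ℤ.* p ℤ.* (0ℤ ℤ.+ x))
           (≡.trans (const-⊛ δ (X ⊛ t) (suc k)) (cong (δ ℤ.*_) (X-* t k))) ⟩
    δ ℤ.* p ℤ.* (0ℤ ℤ.+ δ ℤ.* t k)     ≡⟨ rearrange δ p (t k) ⟩
    (δ ℤ.* δ) ℤ.* (p ℤ.* t k)          ≡⟨ cong (ℤ._* (p ℤ.* t k)) δ²≡1 ⟩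
    1ℤ ℤ.* twist δ t k                 ≡⟨ ℤ.*-identityˡ (twist δ t k) ⟩
    twist δ t k                        ≡⟨ X-* (twist δ t) k ⟨
    (X ⊛ twist δ t) (suc k)            ≡⟨ ℤ.+-identityˡ _ ⟨
    0ℤ ℤ.+ (X ⊛ twist δ t) (suc k)     ∎
    where
    open ≡.≡-Reasoning
    p = δ ℤ.^ k
    rearrange : ∀ d p t → d ℤ.* p ℤ.* (0ℤ ℤ.+ d ℤ.* t) ≡ (d ℤ.* d) ℤ.* (p ℤ.* t)
    rearrange = solve-∀
  solution : const 1ℤ ⊕ X ⊛ twist δ t ≈ const 1ℤ ⊕ X ⊛ (twist δ a ⊛ (const 1ℤ ⊕ X ⊛ twist δ t))
  solution = +-congˡ {const 1ℤ} (*-congˡ {X} (begin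
    twist δ t
      ≈⟨ (λ k → cong (δ ℤ.^ k ℤ.*_) (t-eq k)) ⟩
    twist δ (a ⊛ (const 1ℤ ⊕ const δ ⊛ (X ⊛ t)))
      ≈⟨ twist-* δ a (const 1ℤ ⊕ const δ ⊛ (X ⊛ t)) ⟩
    twist δ a ⊛ twist δ (const 1ℤ ⊕ const δ ⊛ (X ⊛ t))
      ≈⟨ *-congˡ {twist δ a} twist-1+δX ⟩
    twist δ a ⊛ (const 1ℤ ⊕ X ⊛ twist δ t) ∎))
    where open ≈

D₊-solution : ∀ m f t → let a = λ k → + f (m ℕ.+ k) in
  t ≈ a ⊛ (const 1ℤ ⊕ ⊝ (X ⊛ t)) → ∀ n → D₊ (seg m (suc n) f) ≡ -1ℤ ℤ.^ n ℤ.* t n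
D₊-solution m f t t-eq n = ≡.trans
  (det-cong {suc n} (A≡toeplitz 1ℤ a (seg m (suc n) f) (λ _ → ≡.refl)))
  (toeplitzDet-solution 1ℤ ≡.refl a t (trans t-eq
    (solve 3 (λ x a t → a :* (con 1ℤ :+ :- (x :* t)) := a :* (con 1ℤ :+ con -1ℤ :* (x :* t)))
      refl X a t)) n)
  where a = λ k → + f (m ℕ.+ k)

D₋-solution : ∀ m f t → let a = λ k → + f (m ℕ.+ k) in
  t ≈ a ⊛ (const 1ℤ ⊕ X ⊛ t) → ∀ n → D₋ (seg m (suc n) f) ≡ t n
D₋-solution m f t t-eq n = ≡.trans
  (det-cong {suc n} (A≡toeplitz -1ℤ a (seg m (suc n) f) (λ _ → ≡.refl)))
  (≡.trans (toeplitzDet-solution -1ℤ ≡.refl a t (trans t-eq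
    (solve 3 (λ x a t → a :* (con 1ℤ :+ x :* t) := a :* (con 1ℤ :+ con 1ℤ :* (x :* t)))
      refl X a t)) n)
    (≡.trans (cong (ℤ._* t n) (ℤ.^-zeroˡ n)) (ℤ.*-identityˡ (t n))))
  where a = λ k → + f (m ℕ.+ k)

-- Weighted Schröder paths

sum-map-++ : ∀ {a} {A : Set a} (w : A → ℕ) xs ys →
  List.sum (map w (xs ++ ys)) ≡ List.sum (map w xs) ℕ.+ List.sum (map w ys)
sum-map-++ w xs ys = ≡.trans (cong List.sum (map-++ w xs ys)) (List.sum-++ (map w xs) (map w ys))

sum-map-scale : ∀ {a b} {A : Set a} {B : Set b} c (v : A → ℕ) (w : B → ℕ) (g : A → B) →
  (∀ x → w (g x) ≡ c ℕ.* v x) → ∀ xs → List.sum (map w (map g xs)) ≡ c ℕ.* List.sum (map v xs)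
sum-map-scale c v w g wg≡cv []       = ≡.sym (ℕ.*-zeroʳ c)
sum-map-scale c v w g wg≡cv (x ∷ xs) = ≡.trans
  (cong₂ ℕ._+_ (wg≡cv x) (sum-map-scale c v w g wg≡cv xs))
  (≡.sym (ℕ.*-distribˡ-+ c (v x) (List.sum (map v xs))))

sum-map-invariant : ∀ {a b} {A : Set a} {B : Set b} (v : A → ℕ) (w : B → ℕ) (g : A → B) →
  (∀ x → w (g x) ≡ v x) → ∀ xs → List.sum (map w (map g xs)) ≡ List.sum (map v xs)
sum-map-invariant v w g wg≡v xs = ≡.trans
  (sum-map-scale 1 v w g (λ x → ≡.trans (wg≡v x) (≡.sym (ℕ.*-identityˡ (v x)))) xs)
  (ℕ.*-identityˡ _)

length-filter : ∀ {a p} {A : Set a} {P : A → Set p} (P? : Decidable P) xs →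
  length (filter P? xs) ≡ List.sum (map (λ x → if does (P? x) then 1 else 0) xs)
length-filter P? []       = ≡.refl
length-filter P? (x ∷ xs) with does (P? x)
... | true  = cong suc (length-filter P? xs)
... | false = length-filter P? xs

-- y + 2 n, arranged so as to reduce like the length index of Path.
span : ℕ → ℕ → ℕ
span zero    zero    = 0
span zero    (suc n) = suc (suc (span zero n))
span (suc y) n       = suc (span y n)

span-suc : ∀ y n → span y (suc n) ≡ suc (suc (span y n))
span-suc zero    n = ≡.refl
span-suc (suc y) n = cong suc (span-suc y n)

span-0ʳ : ∀ y → span y 0 ≡ y
span-0ʳ zero    = ≡.refl
span-0ʳ (suc y) = cong suc (span-0ʳ y)

span-0ˡ : ∀ n → span 0 n ≡ 2 ℕ.* n
span-0ˡ zero    = ≡.refl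
span-0ˡ (suc n) = cong suc (≡.trans (cong suc (span-0ˡ n)) (≡.sym (ℕ.+-suc n (n ℕ.+ 0))))

-- Each unit of height costs a down step, so a path shorter than its starting height cannot reach
-- the axis.
paths-short  : ∀ ℓ {y} → ℓ ℕ.< y → paths y ℓ ≡ []
levels-short : ∀ ℓ {y} → ℓ ℕ.≤ y → levelFrom y ℓ ≡ []

paths-short zero    (ℕ.s≤s _)         = ≡.refl
paths-short (suc ℓ) (ℕ.s≤s ℓ<y) = cong₂ _++_
  (cong (map u∷_) (paths-short ℓ (ℕ.m<n⇒m<1+n (ℕ.m<n⇒m<1+n ℓ<y))))
  (cong₂ _++_ (cong (map d∷_) (paths-short ℓ ℓ<y)) (levels-short ℓ (ℕ.<⇒≤ (ℕ.m<n⇒m<1+n ℓ<y))))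

levels-short zero    _   = ≡.refl
levels-short (suc ℓ) ℓ<y = cong (map h∷_) (paths-short ℓ ℓ<y)

Weight : Set
Weight = ∀ {y ℓ} → Path y ℓ → ℕ

total : Weight → ℕ → ℕ → ℕ
total w y ℓ = List.sum (map w (paths y ℓ))

series : Weight → ℕ → Series
series w y n = + total w y (span y n)

total-split : ∀ {y ℓ} (w : Path y (suc ℓ) → ℕ) → List.sum (map w (paths y (suc ℓ))) ≡
  List.sum (map w (upFrom y ℓ)) ℕ.+
    (List.sum (map w (downFrom y ℓ)) ℕ.+ List.sum (map w (levelFrom y ℓ)))
total-split {y} {ℓ} w = ≡.trans (sum-map-++ w (upFrom y ℓ) _)
  (cong (λ a → List.sum (map w (upFrom y ℓ)) ℕ.+ a) (sum-map-++ w (downFrom y ℓ) _))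

-- Only steps starting on the axis may affect the weight; above it, sorting paths by their first
-- step gives an unweighted recurrence.
record GroundLevel (w : Weight) : Set where
  field
    up    : ∀ {y ℓ} (p : Path (suc (suc y)) ℓ) → w (u∷ p) ≡ w p
    down  : ∀ {y ℓ} (p : Path y ℓ) → w (d∷ p) ≡ w p
    level : ∀ {y ℓ} (p : Path (suc y) ℓ) → w (h∷ p) ≡ w p

module _ {w : Weight} (ground : GroundLevel w) where
  open GroundLevel ground

  total-suc : ∀ y ℓ → total w (suc y) (suc (suc ℓ)) ≡
    total w y (suc ℓ) ℕ.+ (total w (suc y) ℓ ℕ.+ total w (suc (suc y)) (suc ℓ))
  total-suc y ℓ = ≡.trans (total-split {suc y} {suc ℓ} w) (≡.trans
    (cong₂ ℕ._+_ (sum-map-invariant w w u∷_ up (paths (suc (suc y)) (suc ℓ)))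
      (cong₂ ℕ._+_ (sum-map-invariant w w d∷_ down (paths y (suc ℓ)))
                   (sum-map-invariant w w h∷_ level (paths (suc y) ℓ))))
    (rearrange (total w (suc (suc y)) (suc ℓ)) (total w y (suc ℓ)) (total w (suc y) ℓ)))
    where
    rearrange : ∀ a b c → a ℕ.+ (b ℕ.+ c) ≡ b ℕ.+ (c ℕ.+ a)
    rearrange = ℕ.solve-∀

  -- When length and height agree, a first step `u` or `h` leaves too little length for the descent,
  -- so only `d` remains.
  total-steepest : ∀ y → total w (suc y) (suc y) ≡ total w y y
  total-steepest y = ≡.trans (total-split {suc y} {y} w) (cong₂ ℕ._+_ {y = 0}
    (cong (λ ps → List.sum (map w (map u∷_ ps))) (paths-short y (ℕ.m<n⇒m<1+n (ℕ.n<1+n y))))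
    (≡.trans (cong₂ ℕ._+_ (sum-map-invariant w w d∷_ down (paths y y))
               (cong (λ ps → List.sum (map w ps)) (levels-short y (ℕ.n≤1+n y))))
             (ℕ.+-identityʳ (total w y y))))

  -- The index n is half the excess of length over height. A first step `d` preserves it, while `h`
  -- and `u` each lower it by one, whence the common factor X.
  series-firstPassage : IsFirstPassage (series w)
  series-firstPassage = firstPassage step
    where
    step : ∀ y → series w (suc y) ≈ series w y ⊕ X ⊛ (series w (suc y) ⊕ series w (suc (suc y)))
    step y zero    = ≡.trans (cong +_ steepest) (≡.sym (ℤ.+-identityʳ _))
      where
      steepest : total w (suc y) (suc (span y 0)) ≡ total w y (span y 0)
      steepest rewrite span-0ʳ y = total-steepest y
    step y (suc n) = ≡.trans (cong +_ recurrence)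
      (cong (λ a → series w y (suc n) ℤ.+ a)
        (≡.sym (X-* (series w (suc y) ⊕ series w (suc (suc y))) n)))
      where
      recurrence : total w (suc y) (suc (span y (suc n))) ≡ total w y (span y (suc n)) ℕ.+
        (total w (suc y) (suc (span y n)) ℕ.+ total w (suc (suc y)) (suc (suc (span y n))))
      recurrence rewrite span-suc y n = total-suc y (suc (span y n))

  series-1 : series w 1 ≈ series w 0 ⊛ 𝕊
  series-1 = firstPassage-1 series-firstPassage

-- Paths with coloured low level steps

lowWeight : ℕ → Weight
lowWeight t p = t ℕ.^ low p

lowWeight-ground : ∀ t → GroundLevel (lowWeight t)
lowWeight-ground t = record { up = λ _ → ≡.refl ; down = λ _ → ≡.refl ; level = λ _ → ≡.refl }

lowSeries : ℕ → Series
lowSeries t n = + List.sum (map (λ p → t ℕ.^ low p) (all𝒫 n))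

-- A nonempty path starts with a low level step, of weight t, or with `u`. In the second case
-- `series-1` factors the rest at its first return to the axis.
lowSeries-equation : ∀ t →
  lowSeries t ≈ const 1ℤ ⊕ X ⊛ (const (+ t) ⊛ lowSeries t ⊕ lowSeries t ⊛ 𝕊)
lowSeries-equation t = begin
  lowSeries t                                          ≈⟨ lowSeries≈V ⟩
  V 0                                                  ≈⟨ step ⟩
  const 1ℤ ⊕ X ⊛ (const (+ t) ⊛ V 0 ⊕ V 1)
    ≈⟨ +-congˡ {const 1ℤ} (*-congˡ {X} (+-congˡ {const (+ t) ⊛ V 0}
         (series-1 (lowWeight-ground t)))) ⟩
  const 1ℤ ⊕ X ⊛ (const (+ t) ⊛ V 0 ⊕ V 0 ⊛ 𝕊)
    ≈⟨ +-congˡ {const 1ℤ} (*-congˡ {X} (+-cong (*-congˡ {const (+ t)} lowSeries≈V)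
         (*-congʳ {𝕊} lowSeries≈V))) ⟨
  const 1ℤ ⊕ X ⊛ (const (+ t) ⊛ lowSeries t ⊕ lowSeries t ⊛ 𝕊) ∎
  where
  open ≈
  w : Weight
  w = lowWeight t
  V = series w
  lowSeries≈V : lowSeries t ≈ V 0
  lowSeries≈V n = cong (λ ℓ → + total w 0 ℓ) (≡.sym (span-0ˡ n))
  recurrence : ∀ ℓ → total w 0 (suc (suc ℓ)) ≡ t ℕ.* total w 0 ℓ ℕ.+ total w 1 (suc ℓ)
  recurrence ℓ = ≡.trans (total-split {0} {suc ℓ} w) (≡.trans
    (cong₂ ℕ._+_ (sum-map-invariant w w u∷_ (λ _ → ≡.refl) (paths 1 (suc ℓ)))
                 (sum-map-scale t w w h∷_ (λ _ → ≡.refl) (paths 0 ℓ)))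
    (ℕ.+-comm (total w 1 (suc ℓ)) (t ℕ.* total w 0 ℓ)))
  step : V 0 ≈ const 1ℤ ⊕ X ⊛ (const (+ t) ⊛ V 0 ⊕ V 1)
  step zero    = ≡.refl
  step (suc n) = ≡.trans (cong +_ (recurrence (span 0 n))) (≡.trans
    (cong (ℤ._+ V 1 n)
      (≡.trans (ℤ.pos-* t (total w 0 (span 0 n))) (≡.sym (const-⊛ (+ t) (V 0) n))))
    (≡.sym (≡.trans (ℤ.+-identityˡ _) (X-* (const (+ t) ⊛ V 0 ⊕ V 1) n))))

-- Paths without low level steps and without peaks of height 1

restricted : Weight
restricted p = if does (low p ℕ.≟ 0 ×-dec peaks₁ p ℕ.≟ 0) then 1 else 0

restricted-ground : GroundLevel restricted
restricted-ground = record { up = λ _ → ≡.refl ; down = λ _ → ≡.refl ; level = λ _ → ≡.refl }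

private
  -- Whether a `u` from the axis begins a peak depends on the step after it, so the weight of the
  -- extended path is treated as a weight of its own.
  restricted-u : ∀ {ℓ} → Path 1 ℓ → ℕ
  restricted-u p = restricted (u∷ p)

restricted-levels : ∀ ℓ →
  List.sum (map restricted-u (levelFrom 1 ℓ)) ≡ List.sum (map restricted (levelFrom 1 ℓ))
restricted-levels zero    = ≡.refl
restricted-levels (suc ℓ) = ≡.trans
  (sum-map-invariant restricted restricted-u h∷_ (λ _ → ≡.refl) (paths 1 ℓ))
  (≡.sym (sum-map-invariant restricted restricted h∷_ (λ _ → ≡.refl) (paths 1 ℓ)))

-- Sorted by the second step: `d` would complete a peak of height 1 and has weight 0, while `u` and
-- `h` leave the weight of the rest unchanged.
restricted-raised : ∀ ℓ → List.sum (map restricted (upFrom 0 (suc ℓ))) ≡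
  total restricted 2 ℓ ℕ.+ List.sum (map restricted (levelFrom 1 ℓ))
restricted-raised ℓ = ≡.trans
  (sum-map-invariant restricted-u restricted u∷_ (λ _ → ≡.refl) (paths 1 (suc ℓ)))
  (≡.trans (total-split {1} {ℓ} restricted-u)
    (cong₂ ℕ._+_ (sum-map-invariant restricted restricted-u u∷_ (λ _ → ≡.refl) (paths 2 ℓ))
      (cong₂ ℕ._+_ {y = 0} (sum-map-scale 0 restricted restricted-u d∷_ peaked (paths 0 ℓ))
                           (restricted-levels ℓ))))
  where
  peaked : ∀ {ℓ} (p : Path 0 ℓ) → restricted (u∷ (d∷ p)) ≡ 0
  peaked p with does (low p ℕ.≟ 0)
  ... | true  = ≡.refl
  ... | false = ≡.refl

-- An admissible nonempty path is `u` followed by a path from height 1 that does not descend at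
-- once. The paths that do descend at once are counted by the second summand, added on the left to
-- avoid subtraction.
restricted-recurrence : ∀ ℓ →
  total restricted 0 (suc (suc ℓ)) ℕ.+ total restricted 0 ℓ ≡ total restricted 1 (suc ℓ)
restricted-recurrence ℓ = begin
  total restricted 0 (suc (suc ℓ)) ℕ.+ T
    ≡⟨ cong (ℕ._+ T) (total-split {0} {suc ℓ} restricted) ⟩
  List.sum (map restricted (upFrom 0 (suc ℓ))) ℕ.+
    List.sum (map restricted (levelFrom 0 (suc ℓ))) ℕ.+ T
    ≡⟨ cong₂ (λ a b → a ℕ.+ b ℕ.+ T) (restricted-raised ℓ)
         (sum-map-scale 0 restricted restricted h∷_ (λ _ → ≡.refl) (paths 0 ℓ)) ⟩
  total restricted 2 ℓ ℕ.+ L ℕ.+ 0 ℕ.+ T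
    ≡⟨ rearrange (total restricted 2 ℓ) L T ⟩
  total restricted 2 ℓ ℕ.+ (T ℕ.+ L)
    ≡⟨ cong₂ (λ a b → a ℕ.+ (b ℕ.+ L))
         (sum-map-invariant restricted restricted u∷_ (λ _ → ≡.refl) (paths 2 ℓ))
         (sum-map-invariant restricted restricted d∷_ (λ _ → ≡.refl) (paths 0 ℓ)) ⟨
  List.sum (map restricted (upFrom 1 ℓ)) ℕ.+
    (List.sum (map restricted (downFrom 1 ℓ)) ℕ.+ L)
    ≡⟨ total-split {1} {ℓ} restricted ⟨
  total restricted 1 (suc ℓ) ∎
  where
  open ≡.≡-Reasoning
  T = total restricted 0 ℓ
  L = List.sum (map restricted (levelFrom 1 ℓ))
  rearrange : ∀ a b c → a ℕ.+ b ℕ.+ 0 ℕ.+ c ≡ a ℕ.+ (c ℕ.+ b)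
  rearrange = ℕ.solve-∀

restrictedSeries : Series
restrictedSeries n = + A114710 n

restrictedSeries-equation :
  restrictedSeries ⊕ X ⊛ restrictedSeries ≈ const 1ℤ ⊕ X ⊛ (restrictedSeries ⊛ 𝕊)
restrictedSeries-equation = begin
  restrictedSeries ⊕ X ⊛ restrictedSeries  ≈⟨ +-cong series≈V (*-congˡ {X} series≈V) ⟩
  V 0 ⊕ X ⊛ V 0                            ≈⟨ step ⟩
  const 1ℤ ⊕ X ⊛ V 1
    ≈⟨ +-congˡ {const 1ℤ} (*-congˡ {X} (series-1 restricted-ground)) ⟩
  const 1ℤ ⊕ X ⊛ (V 0 ⊛ 𝕊)
    ≈⟨ +-congˡ {const 1ℤ} (*-congˡ {X} (*-congʳ {𝕊} series≈V)) ⟨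
  const 1ℤ ⊕ X ⊛ (restrictedSeries ⊛ 𝕊)    ∎
  where
  open ≈
  V = series restricted
  series≈V : restrictedSeries ≈ V 0
  series≈V n = ≡.trans
    (cong +_ (length-filter (λ p → low p ℕ.≟ 0 ×-dec peaks₁ p ℕ.≟ 0) (all𝒫 n)))
    (cong (λ ℓ → + total restricted 0 ℓ) (≡.sym (span-0ˡ n)))
  step : V 0 ⊕ X ⊛ V 0 ≈ const 1ℤ ⊕ X ⊛ V 1
  step zero    = ≡.refl
  step (suc n) = ≡.trans (cong (λ a → V 0 (suc n) ℤ.+ a) (X-* (V 0) n))
    (≡.trans (cong +_ (restricted-recurrence (span 0 n)))
      (≡.sym (≡.trans (ℤ.+-identityˡ _) (X-* (V 1) n))))

-- The nine evaluations

X*-shift : ∀ f → X ⊛ shift f ≈ f ⊕ ⊝ const (f 0)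
X*-shift f zero    = ≡.sym (ℤ.+-inverseʳ (f 0))
X*-shift f (suc n) = ≡.trans (X-* (shift f) n) (≡.sym (ℤ.+-identityʳ (f (suc n))))

-- The bracket is s (2 s - 1) = s S, so this reads s = 1 + x s S. The evaluations `D₊[S₀]`,
-- `D₋[S₀]`, `D₊[s₁]` and `D₋[s₀]` are rearrangements of it, using S = 2 s - 1 and, for shifted
-- series, `X*-shift`.
𝕤-quadratic : 𝕤 ≈ const 1ℤ ⊕ X ⊛ (const (+ 2) ⊛ 𝕤 ⊛ 𝕤 ⊕ ⊝ 𝕤)
𝕤-quadratic = 2*-cancel $
  eliminate (const 1ℤ) 𝕊-quadratic $
  -- The multiplier comes from (S² + S) - (4 s² - 2 s) = (S + 2 s)(1 + S - 2 s).
  eliminate (const 1ℤ ⊕ ⊝ (X ⊛ (𝕊 ⊕ const (+ 2) ⊛ 𝕤))) 2𝕤≈1+𝕊 $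
  solve 3 (λ x s S →
    con (+ 2) :* s :+ con 1ℤ :* (con 1ℤ :+ x :* (S :+ S :* S))
      :+ (con 1ℤ :+ :- (x :* (S :+ con (+ 2) :* s))) :* (con 1ℤ :+ S)
      := con (+ 2) :* (con 1ℤ :+ x :* (con (+ 2) :* s :* s :+ :- s)) :+ con 1ℤ :* S
           :+ (con 1ℤ :+ :- (x :* (S :+ con (+ 2) :* s))) :* (con (+ 2) :* s))
    refl X 𝕤 𝕊

-- The solution is 1 + S, not S: its constant term is S₁ = 2, which is why the formula starts at n =
-- 2.
D₊[S₁]-equation : const 1ℤ ⊕ 𝕊 ≈ shift 𝕊 ⊛ (const 1ℤ ⊕ ⊝ (X ⊛ (const 1ℤ ⊕ 𝕊)))
D₊[S₁]-equation = X*-cancel $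
  eliminate (⊝ const 1ℤ) 𝕊-quadratic $
  eliminate (⊝ (const 1ℤ ⊕ ⊝ (X ⊛ (const 1ℤ ⊕ 𝕊)))) (X*-shift 𝕊) $
  solve 3 (λ x S a →
    x :* (con 1ℤ :+ S) :+ (:- con 1ℤ) :* (con 1ℤ :+ x :* (S :+ S :* S))
      :+ (:- (con 1ℤ :+ :- (x :* (con 1ℤ :+ S)))) :* (S :+ :- con 1ℤ)
      := x :* (a :* (con 1ℤ :+ :- (x :* (con 1ℤ :+ S)))) :+ (:- con 1ℤ) :* S
           :+ (:- (con 1ℤ :+ :- (x :* (con 1ℤ :+ S)))) :* (x :* a))
    refl X 𝕊 (shift 𝕊)

-- Let Z be the path series. Comparing its equation times S - 1 with the equation of S times Z gives
-- S - 1 = 2 x Z (2 - S), which is the claim times x.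
D₋[S₁]-equation : const (+ 2) ⊛ lowSeries 4 ≈ shift 𝕊 ⊛ (const 1ℤ ⊕ X ⊛ (const (+ 2) ⊛ lowSeries 4))
D₋[S₁]-equation = X*-cancel $
  eliminate (𝕊 ⊕ ⊝ const 1ℤ) (lowSeries-equation 4) $
  eliminate (⊝ lowSeries 4) 𝕊-quadratic $
  eliminate (⊝ (const 1ℤ ⊕ X ⊛ (const (+ 2) ⊛ lowSeries 4))) (X*-shift 𝕊) $
  solve 4 (λ x S a Z →
    x :* (con (+ 2) :* Z) :+ (S :+ :- con 1ℤ) :* (con 1ℤ :+ x :* (con (+ 4) :* Z :+ Z :* S))
      :+ (:- Z) :* (con 1ℤ :+ x :* (S :+ S :* S))
      :+ (:- (con 1ℤ :+ x :* (con (+ 2) :* Z))) :* (S :+ :- con 1ℤ)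
      := x :* (a :* (con 1ℤ :+ x :* (con (+ 2) :* Z))) :+ (S :+ :- con 1ℤ) :* Z :+ (:- Z) :* S
           :+ (:- (con 1ℤ :+ x :* (con (+ 2) :* Z))) :* (x :* a))
    refl X 𝕊 (shift 𝕊) (lowSeries 4)

D₊[S₀]-equation : 𝕤 ≈ 𝕊 ⊛ (const 1ℤ ⊕ ⊝ (X ⊛ 𝕤))
D₊[S₀]-equation =
  eliminate (⊝ (const 1ℤ ⊕ ⊝ (X ⊛ 𝕤))) 𝕊≈2𝕤-1 $
  eliminate (⊝ const 1ℤ) 𝕤-quadratic $
  solve 3 (λ x s S →
    s :+ (:- (con 1ℤ :+ :- (x :* s))) :* (con (+ 2) :* s :+ :- con 1ℤ)
      :+ (:- con 1ℤ) :* (con 1ℤ :+ x :* (con (+ 2) :* s :* s :+ :- s))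
      := S :* (con 1ℤ :+ :- (x :* s)) :+ (:- (con 1ℤ :+ :- (x :* s))) :* S :+ (:- con 1ℤ) :* s)
    refl X 𝕤 𝕊

D₋[S₀]-equation : shift 𝕤 ≈ 𝕊 ⊛ (const 1ℤ ⊕ X ⊛ shift 𝕤)
D₋[S₀]-equation = X*-cancel $
  eliminate (const 1ℤ) 𝕤-quadratic $
  eliminate (⊝ (X ⊛ 𝕤)) 𝕊≈2𝕤-1 $
  eliminate (const 1ℤ ⊕ ⊝ (X ⊛ 𝕊)) (X*-shift 𝕤) $
  solve 4 (λ x s S b →
    x :* b :+ con 1ℤ :* (con 1ℤ :+ x :* (con (+ 2) :* s :* s :+ :- s))
      :+ (:- (x :* s)) :* (con (+ 2) :* s :+ :- con 1ℤ)
      :+ (con 1ℤ :+ :- (x :* S)) :* (s :+ :- con 1ℤ)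
      := x :* (S :* (con 1ℤ :+ x :* b)) :+ con 1ℤ :* s :+ (:- (x :* s)) :* S
           :+ (con 1ℤ :+ :- (x :* S)) :* (x :* b))
    refl X 𝕤 𝕊 (shift 𝕤)

D₊[s₁]-equation : 𝕊 ≈ shift 𝕤 ⊛ (const 1ℤ ⊕ ⊝ (X ⊛ 𝕊))
D₊[s₁]-equation = X*-cancel $
  eliminate (⊝ const 1ℤ) 𝕤-quadratic $
  eliminate (X ⊛ 𝕤) 𝕊≈2𝕤-1 $
  eliminate (⊝ (const 1ℤ ⊕ ⊝ (X ⊛ 𝕊))) (X*-shift 𝕤) $
  solve 4 (λ x s S b →
    x :* S :+ (:- con 1ℤ) :* (con 1ℤ :+ x :* (con (+ 2) :* s :* s :+ :- s))
      :+ (x :* s) :* (con (+ 2) :* s :+ :- con 1ℤ)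
      :+ (:- (con 1ℤ :+ :- (x :* S))) :* (s :+ :- con 1ℤ)
      := x :* (b :* (con 1ℤ :+ :- (x :* S))) :+ (:- con 1ℤ) :* s :+ (x :* s) :* S
           :+ (:- (con 1ℤ :+ :- (x :* S))) :* (x :* b))
    refl X 𝕤 𝕊 (shift 𝕤)

-- As for `D₋[S₁]-equation`, with s in place of S: the comparison gives s - 1 = x Z (2 - s), because
-- (3 + S)(s - 1) = 2 s² - 2.
D₋[s₁]-equation : lowSeries 3 ≈ shift 𝕤 ⊛ (const 1ℤ ⊕ X ⊛ lowSeries 3)
D₋[s₁]-equation = X*-cancel $
  eliminate (𝕤 ⊕ ⊝ const 1ℤ) (lowSeries-equation 3) $
  eliminate (⊝ lowSeries 3) 𝕤-quadratic $
  eliminate (lowSeries 3 ⊛ X ⊛ (𝕤 ⊕ ⊝ const 1ℤ)) 𝕊≈2𝕤-1 $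
  eliminate (⊝ (const 1ℤ ⊕ X ⊛ lowSeries 3)) (X*-shift 𝕤) $
  solve 5 (λ x s S b Z →
    x :* Z :+ (s :+ :- con 1ℤ) :* (con 1ℤ :+ x :* (con (+ 3) :* Z :+ Z :* S))
      :+ (:- Z) :* (con 1ℤ :+ x :* (con (+ 2) :* s :* s :+ :- s))
      :+ (Z :* x :* (s :+ :- con 1ℤ)) :* (con (+ 2) :* s :+ :- con 1ℤ)
      :+ (:- (con 1ℤ :+ x :* Z)) :* (s :+ :- con 1ℤ)
      := x :* (b :* (con 1ℤ :+ x :* Z)) :+ (s :+ :- con 1ℤ) :* Z :+ (:- Z) :* s
           :+ (Z :* x :* (s :+ :- con 1ℤ)) :* S :+ (:- (con 1ℤ :+ x :* Z)) :* (x :* b))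
    refl X 𝕤 𝕊 (shift 𝕤) (lowSeries 3)

-- Let M be the path series. Subtracting M times s = 1 + x s S from s times the equation of M
-- cancels the product x M s S.
D₊[s₀]-equation : restrictedSeries ≈ 𝕤 ⊛ (const 1ℤ ⊕ ⊝ (X ⊛ restrictedSeries))
D₊[s₀]-equation =
  eliminate 𝕤 restrictedSeries-equation $
  eliminate (⊝ restrictedSeries) 𝕤-quadratic $
  eliminate (restrictedSeries ⊛ X ⊛ 𝕤) 𝕊≈2𝕤-1 $
  solve 4 (λ x s S M →
    M :+ s :* (con 1ℤ :+ x :* (M :* S))
      :+ (:- M) :* (con 1ℤ :+ x :* (con (+ 2) :* s :* s :+ :- s))
      :+ (M :* x :* s) :* (con (+ 2) :* s :+ :- con 1ℤ)
      := s :* (con 1ℤ :+ :- (x :* M)) :+ s :* (M :+ x :* M) :+ (:- M) :* s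
           :+ (M :* x :* s) :* S)
    refl X 𝕤 𝕊 restrictedSeries

D₋[s₀]-equation : 𝕊 ≈ 𝕤 ⊛ (const 1ℤ ⊕ X ⊛ 𝕊)
D₋[s₀]-equation =
  eliminate (const 1ℤ) 𝕤-quadratic $
  eliminate (const 1ℤ ⊕ ⊝ (X ⊛ 𝕤)) 𝕊≈2𝕤-1 $
  solve 3 (λ x s S →
    S :+ con 1ℤ :* (con 1ℤ :+ x :* (con (+ 2) :* s :* s :+ :- s))
      :+ (con 1ℤ :+ :- (x :* s)) :* (con (+ 2) :* s :+ :- con 1ℤ)
      := s :* (con 1ℤ :+ x :* S) :+ con 1ℤ :* s :+ (con 1ℤ :+ :- (x :* s)) :* S)
    refl X 𝕤 𝕊

-- Two shifts remove 1 + x from s, so x is cancelled twice. The constant term of 2 + S is s₂ = 3,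
-- which again excludes n = 1.
D₊[s₂]-equation : const (+ 2) ⊕ 𝕊 ≈ shift (shift 𝕤) ⊛ (const 1ℤ ⊕ ⊝ (X ⊛ (const (+ 2) ⊕ 𝕊)))
D₊[s₂]-equation = X*-cancel $ X*-cancel $
  eliminate (⊝ const 1ℤ) 𝕤-quadratic $
  eliminate (X ⊛ 𝕤 ⊕ ⊝ X) 𝕊≈2𝕤-1 $
  eliminate (⊝ (const 1ℤ ⊕ ⊝ (X ⊛ (const (+ 2) ⊕ 𝕊)))) (X*-shift 𝕤) $
  eliminate (⊝ (X ⊛ (const 1ℤ ⊕ ⊝ (X ⊛ (const (+ 2) ⊕ 𝕊))))) (X*-shift (shift 𝕤)) $
  solve 5 (λ x s S b d →
    x :* (x :* (con (+ 2) :+ S))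
      :+ (:- con 1ℤ) :* (con 1ℤ :+ x :* (con (+ 2) :* s :* s :+ :- s))
      :+ (x :* s :+ :- x) :* (con (+ 2) :* s :+ :- con 1ℤ)
      :+ (:- (con 1ℤ :+ :- (x :* (con (+ 2) :+ S)))) :* (s :+ :- con 1ℤ)
      :+ (:- (x :* (con 1ℤ :+ :- (x :* (con (+ 2) :+ S))))) :* (b :+ :- con 1ℤ)
      := x :* (x :* (d :* (con 1ℤ :+ :- (x :* (con (+ 2) :+ S))))) :+ (:- con 1ℤ) :* s
           :+ (x :* s :+ :- x) :* S :+ (:- (con 1ℤ :+ :- (x :* (con (+ 2) :+ S)))) :* (x :* b)
           :+ (:- (x :* (con 1ℤ :+ :- (x :* (con (+ 2) :+ S))))) :* (x :* d))
    refl X 𝕤 𝕊 (shift 𝕤) (shift (shift 𝕤))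

theorem3 : (n : ℕ) → n ≥ 1 →
    (n ≥ 2 → D₊ (seg 1 n S) ≡ -1ℤ ^ (n ∸ 1) * + S (n ∸ 1))
    × (D₋ (seg 1 n S) ≡ + 2 * + A134425 (n ∸ 1))
    × (D₊ (seg 0 n S) ≡ -1ℤ ^ (n ∸ 1) * + s (n ∸ 1))
    × (D₋ (seg 0 n S) ≡ + s n)
    × (D₊ (seg 1 n s) ≡ -1ℤ ^ (n ∸ 1) * + S (n ∸ 1))
    × (D₋ (seg 1 n s) ≡ + A225887 (n ∸ 1))
    × (D₊ (seg 0 n s) ≡ -1ℤ ^ (n ∸ 1) * + A114710 (n ∸ 1))
    × (D₋ (seg 0 n s) ≡ + S (n ∸ 1))
    × (n ≥ 2 → D₊ (seg 2 n s) ≡ -1ℤ ^ (n ∸ 1) * + S (n ∸ 1))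
theorem3 (suc m) _ =
    (λ { (s≤s 1≤m) → ≡.trans (D₊-solution 1 S (const 1ℤ ⊕ 𝕊) D₊[S₁]-equation m)
                           (dropConst 1ℤ 1≤m) })
  , ≡.trans (D₋-solution 1 S (const (+ 2) ⊛ lowSeries 4) D₋[S₁]-equation m)
            (const-⊛ (+ 2) (lowSeries 4) m)
  , D₊-solution 0 S 𝕤 D₊[S₀]-equation m
  , D₋-solution 0 S (shift 𝕤) D₋[S₀]-equation m
  , D₊-solution 1 s 𝕊 D₊[s₁]-equation m
  , D₋-solution 1 s (lowSeries 3) D₋[s₁]-equation m
  , D₊-solution 0 s restrictedSeries D₊[s₀]-equation m
  , D₋-solution 0 s 𝕊 D₋[s₀]-equation m
  , (λ { (s≤s 1≤m) → ≡.trans (D₊-solution 2 s (const (+ 2) ⊕ 𝕊) D₊[s₂]-equation m)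
                           (dropConst (+ 2) 1≤m) })
  where
  -- Only the coefficient at m = 0, that is n = 1, sees the added constant.
  dropConst : ∀ c {m} → 1 ℕ.≤ m → -1ℤ ℤ.^ m ℤ.* (const c ⊕ 𝕊) m ≡ -1ℤ ℤ.^ m ℤ.* + S m
  dropConst c {suc m} _ = cong (-1ℤ ℤ.^ suc m ℤ.*_) (ℤ.+-identityˡ (𝕊 (suc m)))
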